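{- Fix a diagram $D\subseteq[n]\times[n]$ and $k,l\in[n]$, and let $\widehat{D}$ be the diagram obtained from $D$ by removing all boxes in row $k$ or column $l$. Then $$\chi_D(x_1,\dots,x_n)=M(x_1,\dots,x_n)\,\chi_{\widehat{D}}(x_1,\dots,x_{k-1},0,x_{k+1},\dots,x_n)+F(x_1,\dots,x_n),$$ where $F\in\mathbb{Z}_{\ge0}[x_1,\dots,x_n]$ and $$M(x_1,\dots,x_n)=\Big(\prod_{(k,i)\in D}x_k\Big)\Big(\prod_{(i,l)\in D}x_i\Big).$$
   Context: A diagram $D\subseteq[n]\times[n]$ is a set of boxes $(i,j)$ (row $i$, column $j$), identified with its column sequence $(D_1,\dots,D_n)$, $D_j=\{i:(i,j)\in D\}$. For $R,S\subseteq[n]$, $R\le S$ means $\#R=\#S$ and the $k$-th smallest element of $R$ is at most the $k$-th smallest element of $S$ for each $k$; for diagrams $C\le D$ means $C_j\le D_j$ for all $j$. Let $Y$ be the $n\times n$ upper-triangular matrix of indeterminates $y_{ij}$ ($i\le j$), zeros below the diagonal; $Y^R_S$ its submatrix with rows $R$, columns $S$ (empty determinant $=1$). Let $B$ be the invertible upper-triangular complex matrices acting on $\mathbb{C}[Y]$ by $(f\cdot b)(Y)=f(b^{ -1}Y)$. The flagged Weyl module is $\mathcal{M}_D=\mathrm{Span}_{\mathbb{C}}\{\prod_{j=1}^n\det(Y^{C_j}_{D_j}): C\le D\}$. For a $B$-module $N$, $\mathrm{char}(N)(x_1,\dots,x_n)$ is the trace of $\mathrm{diag}(x_1,\dots,x_n)$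 on $N$, and $\mathrm{char}^*(N)(x_1,\dots,x_n)=\mathrm{char}(N)(x_1^{ -1},\dots,x_n^{ -1})$. Set $\chi_D=\mathrm{char}^*\mathcal{M}_D$.
   Formalization: In M a box at (k,l) of D is counted once, not in both products; with double counting the claim fails whenever (k,l)∈D (e.g. n=1, D={(1,1)} would give F=x_1−x_1²). The result is stated over any field of characteristic zero, ℂ included. -}

module Defs where

open import Level using (_⊔_; 0ℓ)
open import Algebra.Apartness.Bundles using (HeytingField; HeytingCommutativeRing)
open import Algebra.Bundles using (CommutativeSemiring; CommutativeRing)
open import Algebra.Definitions.RawMonoid using (sum) renaming (_×_ to multiple)
import Algebra.Definitions.RawSemiring as RawSemiringOps
open import Data.Bool.Base using (if_then_else_)
open import Data.Fin.Base as Fin using (Fin; zero; suc; toℕ; punchIn; cast)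
import Data.Fin.Properties as Fin
open import Data.Fin.Subset using (Subset; inside; outside; ∣_∣; _-_) renaming (⊥ to ∅)
open import Data.Fin.Subset.Properties using (_∈?_)
open import Data.Integer.Base using (ℤ; +_; -[1+_])
import Data.Integer.Properties as ℤ
open import Data.Nat.Base using (ℕ; zero; suc)
import Data.Nat.Properties as ℕ
open import Data.Product.Base using (Σ; ∃; _,_)
open import Data.Vec.Base using (Vec; []; _∷_; lookup; map)
open import Relation.Binary.Structures using (IsEquivalence)
open import Relation.Binary.PropositionalEquality.Core using (_≡_; _≢_; refl)
import Relation.Binary.Reasoning.Setoid as SetoidReasoning
open import Relation.Nullary.Decidable using (yes; no; does)
open import Relation.Nullary.Negation using (contradiction)

module BigOperators {c ℓ} (A : CommutativeSemiring c ℓ) where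
  open CommutativeSemiring A

  ∑ ∏ : ∀ {m} → (Fin m → Carrier) → Carrier
  ∑ = sum +-rawMonoid
  ∏ = sum *-rawMonoid

module Determinant {c ℓ} (A : CommutativeRing c ℓ) where
  open CommutativeRing A hiding (zero)
  open BigOperators commutativeSemiring
  open RawSemiringOps (CommutativeSemiring.rawSemiring commutativeSemiring) using (_^_)

  det : ∀ {m} → (Fin m → Fin m → Carrier) → Carrier
  det {zero}  a = 1#
  det {suc m} a =
    ∑ λ j → (- 1#) ^ toℕ j * (a zero j * det (λ r s → a (suc r) (punchIn j s)))

-- The free commutative A-algebra on V: formal expressions modulo the
-- congruence _≃_ below.  V need not be finite or have decidable equality.
data Poly {c v} (A : Set c) (V : Set v) : Set (c ⊔ v) where
  con     : A → Poly A V
  var     : V → Poly A V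
  _⊕_ _⊗_ : Poly A V → Poly A V → Poly A V

infixl 6 _⊕_
infixl 7 _⊗_

-- Evaluation of a polynomial in a semiring S, given a map on coefficients and
-- values for the variables.  With S a polynomial semiring this is substitution.
module _ {s ℓ} (S : CommutativeSemiring s ℓ) where
  open CommutativeSemiring S

  eval : ∀ {c v} {A : Set c} {V : Set v} →
         (A → Carrier) → (V → Carrier) → Poly A V → Carrier
  eval h ρ (con a) = h a
  eval h ρ (var x) = ρ x
  eval h ρ (p ⊕ q) = eval h ρ p + eval h ρ q
  eval h ρ (p ⊗ q) = eval h ρ p * eval h ρ q

module PolynomialSemiring {c ℓ v} (A : CommutativeSemiring c ℓ) (V : Set v) where
  private
    module A = CommutativeSemiring A
    P = Poly A.Carrier V

  infix 4 _≃_
  data _≃_ : P → P → Set (c ⊔ ℓ ⊔ v) where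
    ≃-refl   : ∀ {p} → p ≃ p
    ≃-sym    : ∀ {p q} → p ≃ q → q ≃ p
    ≃-trans  : ∀ {p q r} → p ≃ q → q ≃ r → p ≃ r
    ⊕-cong   : ∀ {p p′ q q′} → p ≃ p′ → q ≃ q′ → p ⊕ q ≃ p′ ⊕ q′
    ⊗-cong   : ∀ {p p′ q q′} → p ≃ p′ → q ≃ q′ → p ⊗ q ≃ p′ ⊗ q′
    con-cong : ∀ {a b} → a A.≈ b → con a ≃ con b
    con-+    : ∀ a b → con (a A.+ b) ≃ con a ⊕ con b
    con-*    : ∀ a b → con (a A.* b) ≃ con a ⊗ con b
    ⊕-assoc  : ∀ p q r → (p ⊕ q) ⊕ r ≃ p ⊕ (q ⊕ r)
    ⊕-comm   : ∀ p q → p ⊕ q ≃ q ⊕ p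
    ⊕-idˡ    : ∀ p → con A.0# ⊕ p ≃ p
    ⊗-assoc  : ∀ p q r → (p ⊗ q) ⊗ r ≃ p ⊗ (q ⊗ r)
    ⊗-comm   : ∀ p q → p ⊗ q ≃ q ⊗ p
    ⊗-idˡ    : ∀ p → con A.1# ⊗ p ≃ p
    ⊗-zeroˡ  : ∀ p → con A.0# ⊗ p ≃ con A.0#
    distribˡ : ∀ p q r → p ⊗ (q ⊕ r) ≃ p ⊗ q ⊕ p ⊗ r

  ≃-isEquivalence : IsEquivalence _≃_
  ≃-isEquivalence = record { refl = ≃-refl ; sym = ≃-sym ; trans = ≃-trans }

  ⊕-idʳ : ∀ p → p ⊕ con A.0# ≃ p
  ⊕-idʳ p = ≃-trans (⊕-comm _ _) (⊕-idˡ p)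

  ⊗-idʳ : ∀ p → p ⊗ con A.1# ≃ p
  ⊗-idʳ p = ≃-trans (⊗-comm _ _) (⊗-idˡ p)

  ⊗-zeroʳ : ∀ p → p ⊗ con A.0# ≃ con A.0#
  ⊗-zeroʳ p = ≃-trans (⊗-comm _ _) (⊗-zeroˡ p)

  distribʳ : ∀ p q r → (q ⊕ r) ⊗ p ≃ q ⊗ p ⊕ r ⊗ p
  distribʳ p q r = ≃-trans (⊗-comm _ _)
    (≃-trans (distribˡ p q r) (⊕-cong (⊗-comm _ _) (⊗-comm _ _)))

  polySemiring : CommutativeSemiring (c ⊔ v) (c ⊔ ℓ ⊔ v)
  polySemiring = record
    { Carrier = P ; _≈_ = _≃_ ; _+_ = _⊕_ ; _*_ = _⊗_
    ; 0# = con A.0# ; 1# = con A.1#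
    ; isCommutativeSemiring = record
      { isSemiring = record
        { isSemiringWithoutAnnihilatingZero = record
          { +-isCommutativeMonoid = record
            { isMonoid = record
              { isSemigroup = record
                { isMagma = record { isEquivalence = ≃-isEquivalence ; ∙-cong = ⊕-cong }
                ; assoc = ⊕-assoc }
              ; identity = ⊕-idˡ , ⊕-idʳ }
            ; comm = ⊕-comm }
          ; *-cong = ⊗-cong
          ; *-assoc = ⊗-assoc
          ; *-identity = ⊗-idˡ , ⊗-idʳ
          ; distrib = distribˡ , distribʳ }
        ; zero = ⊗-zeroˡ , ⊗-zeroʳ }
      ; *-comm = ⊗-comm } }

module PolynomialRing {c ℓ v} (A : CommutativeRing c ℓ) (V : Set v) where
  private module A = CommutativeRing A
  open PolynomialSemiring A.commutativeSemiring V public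

  ⊖_ : Poly A.Carrier V → Poly A.Carrier V
  ⊖ p = con (A.- A.1#) ⊗ p

  ⊖-inverseʳ : ∀ p → p ⊕ ⊖ p ≃ con A.0#
  ⊖-inverseʳ p = begin
    p ⊕ ⊖ p                              ≈⟨ ⊕-cong (⊗-idˡ p) ≃-refl ⟨
    con A.1# ⊗ p ⊕ ⊖ p                   ≈⟨ distribʳ p _ _ ⟨
    (con A.1# ⊕ con (A.- A.1#)) ⊗ p      ≈⟨ ⊗-cong (con-+ _ _) ≃-refl ⟨
    con (A.1# A.+ A.- A.1#) ⊗ p          ≈⟨ ⊗-cong (con-cong (A.-‿inverseʳ A.1#)) ≃-refl ⟩
    con A.0# ⊗ p                         ≈⟨ ⊗-zeroˡ p ⟩
    con A.0#                             ∎
    where open SetoidReasoning (CommutativeSemiring.setoid polySemiring)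

  polyRing : CommutativeRing (c ⊔ v) (c ⊔ ℓ ⊔ v)
  polyRing = record
    { Carrier = Poly A.Carrier V ; _≈_ = _≃_ ; _+_ = _⊕_ ; _*_ = _⊗_ ; -_ = ⊖_
    ; 0# = con A.0# ; 1# = con A.1#
    ; isCommutativeRing = record
      { isRing = record
        { +-isAbelianGroup = record
          { isGroup = record
            { isMonoid = CommutativeSemiring.+-isMonoid polySemiring
            ; inverse = (λ p → ≃-trans (⊕-comm _ _) (⊖-inverseʳ p)) , ⊖-inverseʳ
            ; ⁻¹-cong = ⊗-cong ≃-refl }
          ; comm = ⊕-comm }
        ; *-cong = ⊗-cong
        ; *-assoc = ⊗-assoc
        ; *-identity = ⊗-idˡ , ⊗-idʳ
        ; distrib = distribˡ , distribʳ }
      ; *-comm = ⊗-comm } }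

-- The column sequence (D₁ , … , Dₙ): i ∈ D j means that the box in row i and
-- column j belongs to D.
Diagram : ℕ → Set
Diagram n = Fin n → Subset n

-- Elements in increasing order.
elements : ∀ {n} (S : Subset n) → Vec (Fin n) ∣ S ∣
elements []            = []
elements (inside  ∷ S) = zero ∷ map suc (elements S)
elements (outside ∷ S) = map suc (elements S)

infix 4 _≤ˢ_ _≤ᴰ_

record _≤ˢ_ {n} (R S : Subset n) : Set where
  field
    card      : ∣ R ∣ ≡ ∣ S ∣
    pointwise : ∀ a → lookup (elements R) a Fin.≤ lookup (elements S) (cast card a)

_≤ᴰ_ : ∀ {n} → Diagram n → Diagram n → Set
C ≤ᴰ D = ∀ j → C j ≤ˢ D j

remove : ∀ {n} → Fin n → Fin n → Diagram n → Diagram n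
remove k l D j = if does (j Fin.≟ l) then ∅ else D j - k

ℤ[x] ℕ[x] : ℕ → Set
ℤ[x] n = Poly ℤ (Fin n)
ℕ[x] n = Poly ℕ (Fin n)

module _ (n : ℕ) where
  ℤ[x]-ring : CommutativeRing 0ℓ 0ℓ
  ℤ[x]-ring = PolynomialRing.polyRing ℤ.+-*-commutativeRing (Fin n)

  ℤ[x]-semiring : CommutativeSemiring 0ℓ 0ℓ
  ℤ[x]-semiring = CommutativeRing.commutativeSemiring ℤ[x]-ring

infix 4 _≋_
_≋_ : ∀ {n} → ℤ[x] n → ℤ[x] n → Set
_≋_ {n} = CommutativeRing._≈_ (ℤ[x]-ring n)

-- The inclusion ℤ≥0[x₁,…,xₙ] → ℤ[x₁,…,xₙ].
fromℕ[x] : ∀ {n} → ℕ[x] n → ℤ[x] n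
fromℕ[x] {n} = eval (ℤ[x]-semiring n) (λ a → con (+ a)) var

setZero : ∀ {n} → Fin n → ℤ[x] n → ℤ[x] n
setZero {n} k = eval (ℤ[x]-semiring n) con
  (λ i → if does (i Fin.≟ k) then con (+ 0) else var i)

-- The product of x_i over the boxes (i , j) of D with i = k or j = l: boxes of
-- row k outside column l, times boxes of column l.  A box at (k , l) is counted
-- once; counting it in both products would make the degrees disagree (for
-- n = 1 and D = {(1,1)} one would need x₁ - x₁² to have coefficients ≥ 0).
removedMonomial : ∀ {n} → Fin n → Fin n → Diagram n → ℤ[x] n
removedMonomial {n} k l D =
    ∏ (λ j → if does (j Fin.≟ l) then con (+ 1)
             else if does (k ∈? D j) then var k else con (+ 1))
  ⊗ ∏ (λ i → if does (i ∈? D l) then var i else con (+ 1))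
  where open BigOperators (ℤ[x]-semiring n)

commutativeRing : ∀ {c ℓ₁ ℓ₂} → HeytingField c ℓ₁ ℓ₂ → CommutativeRing c ℓ₁
commutativeRing K =
  HeytingCommutativeRing.commutativeRing (HeytingField.heytingCommutativeRing K)

CharacteristicZero : ∀ {c ℓ₁ ℓ₂} → HeytingField c ℓ₁ ℓ₂ → Set ℓ₂
CharacteristicZero K = ∀ m → multiple +-rawMonoid (suc m) 1# # 0#
  where
  open HeytingField K using (_#_)
  open CommutativeRing (commutativeRing K) using (+-rawMonoid; 0#; 1#)

module FlaggedWeyl {c ℓ₁ ℓ₂} (K : HeytingField c ℓ₁ ℓ₂) (n : ℕ) where
  private module K = CommutativeRing (commutativeRing K)
  open BigOperators K.commutativeSemiring using () renaming (∑ to ∑ᴷ)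

  Matrix : Set c
  Matrix = Fin n → Fin n → K.Carrier

  record Index : Set where
    constructor y
    field
      row col  : Fin n
      .row≤col : row Fin.≤ col

  K[Y] : Set c
  K[Y] = Poly K.Carrier Index

  open PolynomialRing (commutativeRing K) Index using (_≃_; polyRing; polySemiring)
  open BigOperators polySemiring
  open Determinant polyRing

  Y : Fin n → Fin n → K[Y]
  Y i j with i Fin.≤? j
  ... | yes i≤j = var (y i j i≤j)
  ... | no  _   = con K.0#

  -- det(Y^R_S)
  minor : (R S : Subset n) → ∣ R ∣ ≡ ∣ S ∣ → K[Y]
  minor R S eq = det λ a b → Y (lookup (elements R) a) (lookup (elements S) (cast eq b))

  combination : ∀ {m} → (Fin m → K.Carrier) → (Fin m → K[Y]) → K[Y]
  combination λs vs = ∑ λ a → con (λs a) ⊗ vs a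

  Subspace : Set _
  Subspace = K[Y] → Set (c ⊔ ℓ₁)

  Span : {I : Set} → (I → K[Y]) → Subspace
  Span {I} g f = Σ ℕ λ m → Σ (Fin m → K.Carrier) λ λs → Σ (Fin m → I) λ is →
    f ≃ combination λs (λ a → g (is a))

  generator : (D : Diagram n) → Σ (Diagram n) (_≤ᴰ D) → K[Y]
  generator D (C , C≤D) = ∏ λ j → minor (C j) (D j) (_≤ˢ_.card (C≤D j))

  ℳ : Diagram n → Subspace
  ℳ D = Span (generator D)

  identity : Matrix
  identity i j = if does (i Fin.≟ j) then K.1# else K.0#

  _·_ : Matrix → Matrix → Matrix
  (a · b) i j = ∑ᴷ λ r → a i r K.* b r j

  record B : Set (c ⊔ ℓ₁) where
    field
      matrix inverse : Matrix
      upper          : ∀ i j → j Fin.< i → matrix i j K.≈ K.0#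
      inverseʳ       : ∀ i j → (matrix · inverse) i j K.≈ identity i j
      inverseˡ       : ∀ i j → (inverse · matrix) i j K.≈ identity i j

  -- (f · b)(Y) = f(b⁻¹Y)
  act : B → K[Y] → K[Y]
  act b = eval polySemiring con
    (λ (y i j _) → ∑ λ r → con (B.inverse b i r) ⊗ Y r j)

  record Torus : Set (c ⊔ ℓ₁) where
    field
      entry entry⁻¹ : Fin n → K.Carrier
      inverse       : ∀ i → entry i K.* entry⁻¹ i K.≈ K.1#

  _⁻¹ : Torus → Torus
  t ⁻¹ = record
    { entry   = Torus.entry⁻¹ t
    ; entry⁻¹ = Torus.entry t
    ; inverse = λ i → K.trans (K.*-comm _ _) (Torus.inverse t i) }

  diagonal : (Fin n → K.Carrier) → Matrix
  diagonal t i j = if does (i Fin.≟ j) then t i else K.0#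

  ∑-zero : ∀ {m} (f : Fin m → K.Carrier) → (∀ r → f r K.≈ K.0#) → ∑ᴷ f K.≈ K.0#
  ∑-zero {zero}  f f≈0 = K.refl
  ∑-zero {suc m} f f≈0 =
    K.trans (K.+-cong (f≈0 zero) (∑-zero (λ r → f (suc r)) (λ r → f≈0 (suc r))))
            (K.+-identityˡ K.0#)

  ∑-single : ∀ {m} (f : Fin m → K.Carrier) i →
             (∀ r → i ≢ r → f r K.≈ K.0#) → ∑ᴷ f K.≈ f i
  ∑-single f zero    h =
    K.trans (K.+-congˡ (∑-zero (λ r → f (suc r)) (λ r → h (suc r) λ ())))
            (K.+-identityʳ (f zero))
  ∑-single f (suc i) h =
    K.trans (K.+-cong (h zero λ ())
                      (∑-single (λ r → f (suc r)) i
                        (λ r i≢r → h (suc r) (λ { refl → i≢r refl }))))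
            (K.+-identityˡ (f (suc i)))

  diagonal-≡ : ∀ t i → diagonal t i i K.≈ t i
  diagonal-≡ t i with i Fin.≟ i
  ... | yes _  = K.refl
  ... | no i≢i = contradiction refl i≢i

  diagonal-≢ : ∀ t i j → i ≢ j → diagonal t i j K.≈ K.0#
  diagonal-≢ t i j i≢j with i Fin.≟ j
  ... | yes i≡j = contradiction i≡j i≢j
  ... | no _    = K.refl

  diagonal-· : ∀ t s → (∀ i → t i K.* s i K.≈ K.1#) →
               ∀ i j → (diagonal t · diagonal s) i j K.≈ identity i j
  diagonal-· t s ts≈1 i j = K.trans
    (∑-single _ i (λ r i≢r →
      K.trans (K.*-congʳ (diagonal-≢ t i r i≢r)) (K.zeroˡ _)))
    (K.trans (K.*-congʳ (diagonal-≡ t i)) last)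
    where
    last : t i K.* diagonal s i j K.≈ identity i j
    last with i Fin.≟ j
    ... | yes _ = ts≈1 i
    ... | no  _ = K.zeroʳ (t i)

  diag : Torus → B
  diag t = record
    { matrix   = diagonal (entry t)
    ; inverse  = diagonal (entry⁻¹ t)
    ; upper    = λ i j j<i →
        diagonal-≢ (entry t) i j (λ { refl → ℕ.<-irrefl refl j<i })
    ; inverseʳ = diagonal-· (entry t) (entry⁻¹ t) (inverse t)
    ; inverseˡ = diagonal-· (entry⁻¹ t) (entry t) (inverse (t ⁻¹))
    }
    where open Torus

  record IsBasis (N : Subspace) {m} (b : Fin m → K[Y]) : Set (c ⊔ ℓ₁) where
    field
      member      : ∀ a → N (b a)
      independent : ∀ λs → combination λs b ≃ con K.0# → ∀ a → λs a K.≈ K.0#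
      spanning    : ∀ f → N f → ∃ λ λs → f ≃ combination λs b

  -- τ is the trace of φ on the finite-dimensional subspace N, computed from
  -- the matrix of φ in some basis of N.
  record IsTrace (N : Subspace) (φ : K[Y] → K[Y]) (τ : K.Carrier) : Set (c ⊔ ℓ₁) where
    field
      {dim}   : ℕ
      basis   : Fin dim → K[Y]
      isBasis : IsBasis N basis
      matrix  : Fin dim → Fin dim → K.Carrier
      action  : ∀ b → φ (basis b) ≃ combination (λ a → matrix a b) basis
      trace   : τ K.≈ ∑ᴷ (λ a → matrix a a)

  -- τ is the value char(N)(t).
  IsCharAt : Subspace → Torus → K.Carrier → Set (c ⊔ ℓ₁)
  IsCharAt N t τ = IsTrace N (act (diag t)) τ

  fromℤ : ℤ → K.Carrier
  fromℤ (+ m)    = multiple K.+-rawMonoid m K.1#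
  fromℤ -[1+ m ] = K.- multiple K.+-rawMonoid (suc m) K.1#

  -- The polynomial χ represents the function t ↦ char(N)(t⁻¹) on the torus.
  -- In characteristic zero this determines χ up to _≋_.
  IsDualChar : Subspace → ℤ[x] n → Set (c ⊔ ℓ₁)
  IsDualChar N χ = ∀ t →
    IsCharAt N (t ⁻¹) (eval K.commutativeSemiring fromℤ (Torus.entry t) χ)

-- χ is the dual character χ_D of the flagged Weyl module of D over K.
Isχ : ∀ {c ℓ₁ ℓ₂} (K : HeytingField c ℓ₁ ℓ₂) {n} → Diagram n → ℤ[x] n → Set (c ⊔ ℓ₁)
Isχ K {n} D χ = IsDualChar (ℳ D) χ
  where open FlaggedWeyl K n

{-# OPTIONS --safe #-}

-- χ_D is the sum of the monomials x^C over any basis of ℳ_D formed by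
-- generators g_C, since these are eigenvectors of the torus.  Such bases can be
-- chosen constructively: the generators have coefficients in the prime field of
-- K, where equality with zero is decidable in characteristic zero.
--
-- Choose a basis of ℳ_D̂ in which the generators avoiding row k come first;
-- setting x_k = 0 in χ_D̂ keeps exactly these.  If C ≤ D̂ avoids row k, let C′ ≤ D
-- be C with k added to each column j ≠ l such that k ∈ D_j, and with column l
-- replaced by D_l; then x^C′ = M x^C.  Replacing row k of Y by the k-th unit
-- vector maps g_C′ to ± q g_C, where q is the image of det(Y^{D_l}_{D_l}), a
-- product of variables y_ii and hence not a zero divisor.  So the g_C′ are
-- independent, and F is the sum of the monomials of the generators that extend
-- them to a basis of ℳ_D.

module Submission where

open import Defs
open import Level using (_⊔_; 0ℓ) renaming (suc to lsuc)
open import Algebra.Apartness.Bundles using (HeytingField)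
open import Algebra.Bundles using (CommutativeMonoid; CommutativeRing; CommutativeSemiring)
import Algebra.Definitions.RawSemiring as RawSemiringOps
import Algebra.Morphism.Construct.Identity as Identity
open import Algebra.Morphism.Structures using (module SemiringMorphisms)
import Algebra.Properties.CommutativeMonoid.Sum as MonoidSum
import Algebra.Properties.CommutativeSemigroup as CommutativeSemigroupProperties
import Algebra.Properties.Ring as RingProperties
import Algebra.Properties.Semiring.Mult as SemiringMult
import Algebra.Properties.Semiring.Sum as SemiringSum
import Algebra.Solver.Ring.NaturalCoefficients.Default as SemiringSolver
open import Data.Bool.Base using (if_then_else_; true; false)
open import Data.Empty using (⊥-elim; ⊥-elim-irr)
open import Data.Fin.Base as Fin using (Fin; zero; suc; toℕ; punchIn; cast)
import Data.Fin.Properties as Fin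
open import Data.Fin.Subset using (Subset; inside; outside; ∣_∣; _-_; _∈_; _∉_) renaming (⊥ to ∅)
open import Data.Fin.Subset.Properties using (_∈?_; p─⊥≡p; ∣⊥∣≡0)
open import Data.Integer.Base using (ℤ; +_)
import Data.Integer.Properties as ℤ
open import Data.List.Base as List using (List; []; _∷_; _++_)
open import Data.List.Membership.Propositional using (find; lose) renaming (_∈_ to _∈ᴸ_)
open import Data.List.Membership.Propositional.Properties using (∈-++⁺ˡ; ∈-++⁺ʳ; ∈-map⁺; ∈-allFin)
open import Data.List.Relation.Unary.Any as Any using (Any; here; there)
import Data.List.Relation.Unary.Any.Properties as Any
open import Data.Nat.Base using (ℕ; zero; suc; z≤n; s≤s; s≤s⁻¹; z<s; s<s; compare; less; equal; greater) renaming (_+_ to _ℕ+_; _*_ to _ℕ*_)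
import Data.Nat.Properties as ℕ
open import Data.Product.Base using (Σ; _×_; _,_; proj₁; proj₂)
open import Data.Sum.Base using (_⊎_; inj₁; inj₂)
open import Data.Unit.Polymorphic.Base using (⊤; tt)
open import Data.Vec.Base using ([]; _∷_; here; there; lookup)
open import Data.Vec.Functional using () renaming ([] to []ᶠ; _∷_ to _◂_)
open import Data.Vec.Properties using (lookup-map)
open import Function.Base using (_∘_; id)
open import Relation.Binary.Definitions using (DecidableEquality)
open import Relation.Binary.PropositionalEquality.Core as ≡ using (_≡_; _≢_)
import Relation.Binary.Reasoning.Setoid as SetoidReasoning
open import Relation.Nullary.Decidable using (Dec; yes; no; does; map′; ¬?; dec-true; dec-false)
open import Relation.Nullary.Negation using (¬_; contradiction)
open import Relation.Unary using (Pred; Decidable)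

-- Two obstacles shape the proof. Equality in `K` is not decidable, so classical elimination cannot
-- thin a spanning set out to a basis. The search therefore runs on expressions whose constants are
-- all rational: a projection along the span found so far, again with rational coefficients, sends
-- the next generator either to zero or to a polynomial with an invertible coefficient, which serves
-- as the pivot. The independence and spanning so obtained hold over all of `K`. Moreover,
-- polynomials are expressions modulo a congruence, with no normal form and hence no coefficients or
-- degrees to start from. One operation, division with remainder by a variable, supplies everything:
-- iterated quotients read off coefficients, they end after finitely many steps and so give the fuel
-- for the search, and the quotient undoes multiplication by the variable, which is why diagonal
-- variables can be cancelled.

-- Sums and products over finite index sets; cancellable elements.

module SumProperties {c ℓ} (M : CommutativeMonoid c ℓ) where
  open CommutativeMonoid M
  open MonoidSum M using (sum)

  sum-ε : ∀ {m} (f : Fin m → Carrier) → (∀ i → f i ≈ ε) → sum f ≈ ε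
  sum-ε {zero}  f f≈ε = refl
  sum-ε {suc m} f f≈ε = trans (∙-cong (f≈ε zero) (sum-ε (f ∘ suc) (f≈ε ∘ suc))) (identityˡ ε)

  sum-single : ∀ {m} (f : Fin m → Carrier) i → (∀ r → r ≢ i → f r ≈ ε) → sum f ≈ f i
  sum-single f zero    f≈ε = trans (∙-congˡ (sum-ε _ λ r → f≈ε (suc r) λ ())) (identityʳ _)
  sum-single f (suc i) f≈ε = trans
    (∙-cong (f≈ε zero λ ())
            (sum-single (f ∘ suc) i λ r r≢i → f≈ε (suc r) (r≢i ∘ Fin.suc-injective)))
    (identityˡ _)

module BigOperatorProperties {c ℓ} (A : CommutativeSemiring c ℓ) where
  open CommutativeSemiring A hiding (zero)
  open BigOperators A
  private
    module Sum = MonoidSum +-commutativeMonoid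
    module Product = MonoidSum *-commutativeMonoid

  ∑-cong : ∀ {m} (f g : Fin m → Carrier) → (∀ a → f a ≈ g a) → ∑ f ≈ ∑ g
  ∑-cong f g = Sum.sum-cong-≋ {x = f} {y = g}

  ∏-cong : ∀ {m} (f g : Fin m → Carrier) → (∀ a → f a ≈ g a) → ∏ f ≈ ∏ g
  ∏-cong f g = Product.sum-cong-≋ {x = f} {y = g}

  ∏-distrib-* : ∀ {m} (f g : Fin m → Carrier) → ∏ (λ a → f a * g a) ≈ ∏ f * ∏ g
  ∏-distrib-* = Product.∑-distrib-+

  ∑-zero : ∀ {m} (f : Fin m → Carrier) → (∀ a → f a ≈ 0#) → ∑ f ≈ 0#
  ∑-zero = SumProperties.sum-ε +-commutativeMonoid

  ∏-one : ∀ {m} (f : Fin m → Carrier) → (∀ a → f a ≈ 1#) → ∏ f ≈ 1#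
  ∏-one = SumProperties.sum-ε *-commutativeMonoid

  ∑-single : ∀ {m} (f : Fin m → Carrier) i → (∀ r → r ≢ i → f r ≈ 0#) → ∑ f ≈ f i
  ∑-single = SumProperties.sum-single +-commutativeMonoid

  ∏-single : ∀ {m} (f : Fin m → Carrier) i → (∀ r → r ≢ i → f r ≈ 1#) → ∏ f ≈ f i
  ∏-single = SumProperties.sum-single *-commutativeMonoid

  ∏-zero : ∀ {m} (f : Fin m → Carrier) i → f i ≈ 0# → ∏ f ≈ 0#
  ∏-zero f zero    f≈0 = trans (*-congʳ f≈0) (zeroˡ _)
  ∏-zero f (suc i) f≈0 = trans (*-congˡ (∏-zero (f ∘ suc) i f≈0)) (zeroʳ _)

module Cancellation {c ℓ} (A : CommutativeSemiring c ℓ) where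
  open CommutativeSemiring A hiding (zero)
  open BigOperators A

  Cancellable : Carrier → Set _
  Cancellable x = ∀ y → x * y ≈ 0# → y ≈ 0#

  1-cancellable : Cancellable 1#
  1-cancellable y = trans (sym (*-identityˡ y))

  *-cancellable : ∀ {x y} → Cancellable x → Cancellable y → Cancellable (x * y)
  *-cancellable x-c y-c z xyz≈0 = y-c z (x-c _ (trans (sym (*-assoc _ _ _)) xyz≈0))

  cancellable-cong : ∀ {x y} → x ≈ y → Cancellable x → Cancellable y
  cancellable-cong x≈y x-c z yz≈0 = x-c z (trans (*-congʳ x≈y) yz≈0)

  ∏-cancellable : ∀ {m} (f : Fin m → Carrier) → (∀ a → Cancellable (f a)) → Cancellable (∏ f)
  ∏-cancellable {zero}  f f-c = 1-cancellable
  ∏-cancellable {suc m} f f-c = *-cancellable (f-c zero) (∏-cancellable (f ∘ suc) (f-c ∘ suc))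

-- Polynomial expressions: evaluation, and division with remainder by a variable.

module Evaluation {c ℓ v s ℓ′} (A : CommutativeSemiring c ℓ) {V : Set v}
                  (S : CommutativeSemiring s ℓ′) where
  private
    module A = CommutativeSemiring A
    module S = CommutativeSemiring S
    module ∑ᴬ = BigOperators (PolynomialSemiring.polySemiring A V)
    module ∑ˢ = BigOperators S
  open PolynomialSemiring A V
  open SemiringMorphisms A.rawSemiring S.rawSemiring using (IsSemiringHomomorphism)

  -- `_≃_` is generated by its constructors, so induction on derivations applies: each constructor
  -- becomes a law of `S` or a homomorphism property of `h`.
  eval-cong : ∀ {h} → IsSemiringHomomorphism h → ∀ ρ {p q} → p ≃ q →
              eval S h ρ p S.≈ eval S h ρ q
  eval-cong {h} hom ρ = go
    where
    open IsSemiringHomomorphism hom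
    go : ∀ {p q} → p ≃ q → eval S h ρ p S.≈ eval S h ρ q
    go ≃-refl           = S.refl
    go (≃-sym e)        = S.sym (go e)
    go (≃-trans e e′)   = S.trans (go e) (go e′)
    go (⊕-cong e e′)    = S.+-cong (go e) (go e′)
    go (⊗-cong e e′)    = S.*-cong (go e) (go e′)
    go (con-cong e)     = ⟦⟧-cong e
    go (con-+ a b)      = +-homo a b
    go (con-* a b)      = *-homo a b
    go (⊕-assoc p q r)  = S.+-assoc _ _ _
    go (⊕-comm p q)     = S.+-comm _ _
    go (⊕-idˡ p)        = S.trans (S.+-congʳ 0#-homo) (S.+-identityˡ _)
    go (⊗-assoc p q r)  = S.*-assoc _ _ _
    go (⊗-comm p q)     = S.*-comm _ _
    go (⊗-idˡ p)        = S.trans (S.*-congʳ 1#-homo) (S.*-identityˡ _)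
    go (⊗-zeroˡ p)      =
      S.trans (S.*-congʳ 0#-homo) (S.trans (S.zeroˡ _) (S.sym 0#-homo))
    go (distribˡ p q r) = S.distribˡ _ _ _

  module _ {h : A.Carrier → S.Carrier} (ρ : V → S.Carrier) where

    -- Only the base case of the recursion involves `h`. Asking for its value at zero alone lets
    -- `fromℤ` be used later without a proof that it is a homomorphism.
    eval-∑ : h A.0# S.≈ S.0# → ∀ {m} (f : Fin m → Poly A.Carrier V) →
             eval S h ρ (∑ᴬ.∑ f) S.≈ ∑ˢ.∑ (λ a → eval S h ρ (f a))
    eval-∑ h0 {zero}  f = h0
    eval-∑ h0 {suc m} f = S.+-congˡ (eval-∑ h0 (f ∘ suc))

    eval-∏ : h A.1# S.≈ S.1# → ∀ {m} (f : Fin m → Poly A.Carrier V) →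
             eval S h ρ (∑ᴬ.∏ f) S.≈ ∑ˢ.∏ (λ a → eval S h ρ (f a))
    eval-∏ h1 {zero}  f = h1
    eval-∏ h1 {suc m} f = S.*-congˡ (eval-∏ h1 (f ∘ suc))

module Constants {c ℓ v} (A : CommutativeSemiring c ℓ) (V : Set v) where
  private module A = CommutativeSemiring A
  open PolynomialSemiring A V
  open SemiringMorphisms A.rawSemiring (CommutativeSemiring.rawSemiring polySemiring)
    using (IsSemiringHomomorphism)

  con-isSemiringHomomorphism : IsSemiringHomomorphism con
  con-isSemiringHomomorphism = record
    { isNearSemiringHomomorphism = record
      { +-isMonoidHomomorphism = record
        { isMagmaHomomorphism = record
          { isRelHomomorphism = record { cong = con-cong }
          ; homo = con-+ }
        ; ε-homo = ≃-refl }
      ; *-homo = con-* }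
    ; 1#-homo = ≃-refl }

-- p = at0 v p + v · quot v p, i.e. quot v p = (p − p|ᵥ₌₀) / v.
module Division {c ℓ v} (A : CommutativeSemiring c ℓ) {V : Set v}
                (_≟_ : DecidableEquality V) where
  private
    module A = CommutativeSemiring A
    P = Poly A.Carrier V
  open PolynomialSemiring A V
  open Cancellation polySemiring using (Cancellable)
  open SemiringSolver polySemiring using (solve; _:+_; _:*_; _:=_)
  open SetoidReasoning (CommutativeSemiring.setoid polySemiring)

  at0 : V → P → P
  at0 v = eval polySemiring con (λ w → if does (w ≟ v) then con A.0# else var w)

  at0-cong : ∀ v {p q} → p ≃ q → at0 v p ≃ at0 v q
  at0-cong v = Evaluation.eval-cong A polySemiring
                 (Constants.con-isSemiringHomomorphism A V) _

  -- The product clause is the twisted Leibniz rule pq - p₀q₀ = (p - p₀) q + p₀ (q - q₀), where the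
  -- index 0 stands for `at0 v`.
  quot : V → P → P
  quot v (con a) = con A.0#
  quot v (var w) = if does (w ≟ v) then con A.1# else con A.0#
  quot v (p ⊕ q) = quot v p ⊕ quot v q
  quot v (p ⊗ q) = quot v p ⊗ q ⊕ at0 v p ⊗ quot v q

  at0-quot : ∀ v p → p ≃ at0 v p ⊕ var v ⊗ quot v p
  at0-quot v (con a) = ≃-sym (≃-trans (⊕-cong ≃-refl (⊗-zeroʳ _)) (⊕-idʳ _))
  at0-quot v (var w) with w ≟ v
  ... | yes ≡.refl = ≃-sym (≃-trans (⊕-idˡ _) (⊗-idʳ _))
  ... | no _     = ≃-sym (≃-trans (⊕-cong ≃-refl (⊗-zeroʳ _)) (⊕-idʳ _))
  at0-quot v (p ⊕ q) = ≃-trans (⊕-cong (at0-quot v p) (at0-quot v q))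
    (solve 5 (λ z d z′ d′ x → (z :+ x :* d) :+ (z′ :+ x :* d′) := (z :+ z′) :+ x :* (d :+ d′))
      ≃-refl (at0 v p) (quot v p) (at0 v q) (quot v q) (var v))
  at0-quot v (p ⊗ q) = begin
    p ⊗ q
      ≈⟨ ⊗-cong (at0-quot v p) ≃-refl ⟩
    (at0 v p ⊕ var v ⊗ quot v p) ⊗ q
      ≈⟨ solve 4 (λ z d x q → (z :+ x :* d) :* q := z :* q :+ x :* (d :* q))
           ≃-refl (at0 v p) (quot v p) (var v) q ⟩
    at0 v p ⊗ q ⊕ var v ⊗ (quot v p ⊗ q)
      ≈⟨ ⊕-cong (⊗-cong ≃-refl (at0-quot v q)) ≃-refl ⟩
    at0 v p ⊗ (at0 v q ⊕ var v ⊗ quot v q) ⊕ var v ⊗ (quot v p ⊗ q)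
      ≈⟨ solve 5 (λ z z′ d′ x e → z :* (z′ :+ x :* d′) :+ x :* e := z :* z′ :+ x :* (e :+ z :* d′))
           ≃-refl (at0 v p) (at0 v q) (quot v q) (var v) (quot v p ⊗ q) ⟩
    at0 v p ⊗ at0 v q ⊕ var v ⊗ (quot v p ⊗ q ⊕ at0 v p ⊗ quot v q) ∎

  quot-cong : ∀ v {p q} → p ≃ q → quot v p ≃ quot v q
  quot-cong v ≃-refl = ≃-refl
  quot-cong v (≃-sym e) = ≃-sym (quot-cong v e)
  quot-cong v (≃-trans e e′) = ≃-trans (quot-cong v e) (quot-cong v e′)
  quot-cong v (⊕-cong e e′) = ⊕-cong (quot-cong v e) (quot-cong v e′)
  quot-cong v (⊗-cong e e′) =
    ⊕-cong (⊗-cong (quot-cong v e) e′) (⊗-cong (at0-cong v e) (quot-cong v e′))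
  quot-cong v (con-cong _) = ≃-refl
  quot-cong v (con-+ a b) = ≃-sym (⊕-idˡ _)
  quot-cong v (con-* a b) =
    ≃-sym (≃-trans (⊕-cong (⊗-zeroˡ _) (⊗-zeroʳ _)) (⊕-idˡ _))
  quot-cong v (⊕-assoc p q r) = ⊕-assoc _ _ _
  quot-cong v (⊕-comm p q) = ⊕-comm _ _
  quot-cong v (⊕-idˡ p) = ⊕-idˡ _
  quot-cong v (⊗-assoc p q r) =
    solve 7 (λ dp zp q dq zq r dr →
        (dp :* q :+ zp :* dq) :* r :+ (zp :* zq) :* dr :=
        dp :* (q :* r) :+ zp :* (dq :* r :+ zq :* dr))
      ≃-refl (quot v p) (at0 v p) q (quot v q) (at0 v q) r (quot v r)
  -- The product clause treats `p` and `q` differently. Expanding `q` by `at0-quot`, and contracting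
  -- `p` by it at the end, exchanges their roles.
  quot-cong v (⊗-comm p q) = begin
    quot v p ⊗ q ⊕ at0 v p ⊗ quot v q
      ≈⟨ ⊕-cong (⊗-cong ≃-refl (at0-quot v q)) ≃-refl ⟩
    quot v p ⊗ (at0 v q ⊕ var v ⊗ quot v q) ⊕ at0 v p ⊗ quot v q
      ≈⟨ solve 5 (λ dp zp dq zq x →
           dp :* (zq :+ x :* dq) :+ zp :* dq := dq :* (zp :+ x :* dp) :+ zq :* dp)
           ≃-refl (quot v p) (at0 v p) (quot v q) (at0 v q) (var v) ⟩
    quot v q ⊗ (at0 v p ⊕ var v ⊗ quot v p) ⊕ at0 v q ⊗ quot v p
      ≈⟨ ⊕-cong (⊗-cong ≃-refl (at0-quot v p)) ≃-refl ⟨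
    quot v q ⊗ p ⊕ at0 v q ⊗ quot v p ∎
  quot-cong v (⊗-idˡ p) =
    ≃-trans (⊕-cong (⊗-zeroˡ _) (⊗-idˡ _)) (⊕-idˡ _)
  quot-cong v (⊗-zeroˡ p) =
    ≃-trans (⊕-cong (⊗-zeroˡ _) (⊗-zeroˡ _)) (⊕-idˡ _)
  quot-cong v (distribˡ p q r) =
    solve 6 (λ dp zp q r dq dr →
        dp :* (q :+ r) :+ zp :* (dq :+ dr) := (dp :* q :+ zp :* dq) :+ (dp :* r :+ zp :* dr))
      ≃-refl (quot v p) (at0 v p) q r (quot v q) (quot v r)

  quot-at0 : ∀ v p → quot v (at0 v p) ≃ con A.0#
  quot-at0 v (con a) = ≃-refl
  quot-at0 v (var w) with w ≟ v in eq
  ... | yes _ = ≃-refl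
  ... | no _ rewrite eq = ≃-refl
  quot-at0 v (p ⊕ q) = ≃-trans (⊕-cong (quot-at0 v p) (quot-at0 v q)) (⊕-idˡ _)
  quot-at0 v (p ⊗ q) = ≃-trans
    (⊕-cong (≃-trans (⊗-cong (quot-at0 v p) ≃-refl) (⊗-zeroˡ _))
            (≃-trans (⊗-cong ≃-refl (quot-at0 v q)) (⊗-zeroʳ _)))
    (⊕-idˡ _)

  at0-idem : ∀ v p → at0 v (at0 v p) ≃ at0 v p
  at0-idem v p = ≃-sym (≃-trans (at0-quot v (at0 v p))
    (≃-trans (⊕-cong ≃-refl (≃-trans (⊗-cong ≃-refl (quot-at0 v p)) (⊗-zeroʳ _))) (⊕-idʳ _)))

  quot-var-⊗ : ∀ v p → quot v (var v ⊗ p) ≃ p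
  quot-var-⊗ v p with v ≟ v
  ... | yes _  = ≃-trans (⊕-cong (⊗-idˡ p) (⊗-zeroˡ _)) (⊕-idʳ p)
  ... | no v≢v = contradiction ≡.refl v≢v

  quot^ : ℕ → V → P → P
  quot^ zero    v p = p
  quot^ (suc d) v p = quot^ d v (quot v p)

  quot^-cong : ∀ d v {p q} → p ≃ q → quot^ d v p ≃ quot^ d v q
  quot^-cong zero    v e = e
  quot^-cong (suc d) v e = quot^-cong d v (quot-cong v e)

  quot^-zero : ∀ d v {p} → p ≃ con A.0# → quot^ d v p ≃ con A.0#
  quot^-zero zero    v e = e
  quot^-zero (suc d) v e = quot^-zero d v (quot-cong v e)

  quot^-+ : ∀ d e v {p} → quot^ d v p ≃ con A.0# → quot^ (d ℕ+ e) v p ≃ con A.0#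
  quot^-+ zero    e v eq = quot^-zero e v eq
  quot^-+ (suc d) e v eq = quot^-+ d e v eq

  quot^-+′ : ∀ d e v {p} → quot^ e v p ≃ con A.0# → quot^ (d ℕ+ e) v p ≃ con A.0#
  quot^-+′ zero    e v eq = eq
  quot^-+′ (suc d) e v {p} eq = quot^-+′ d e v (≃-trans (comm e p) (quot-cong v eq))
    where
    comm : ∀ e p → quot^ e v (quot v p) ≃ quot v (quot^ e v p)
    comm zero    p = ≃-refl
    comm (suc e) p = comm e (quot v p)

  quot^-⊕ : ∀ d v p q → quot^ d v (p ⊕ q) ≃ quot^ d v p ⊕ quot^ d v q
  quot^-⊕ zero    v p q = ≃-refl
  quot^-⊕ (suc d) v p q = quot^-⊕ d v (quot v p) (quot v q)

  quot-at0-⊗ : ∀ v p q → quot v (at0 v p ⊗ q) ≃ at0 v p ⊗ quot v q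
  quot-at0-⊗ v p q = ≃-trans
    (⊕-cong (≃-trans (⊗-cong (quot-at0 v p) ≃-refl) (⊗-zeroˡ _))
            (⊗-cong (at0-idem v p) ≃-refl))
    (⊕-idˡ _)

  quot^-at0-⊗ : ∀ d v p q → quot^ d v (at0 v p ⊗ q) ≃ at0 v p ⊗ quot^ d v q
  quot^-at0-⊗ zero    v p q = ≃-refl
  quot^-at0-⊗ (suc d) v p q =
    ≃-trans (quot^-cong d v (quot-at0-⊗ v p q)) (quot^-at0-⊗ d v p (quot v q))

  -- Induction on `d` along the product rule: the first summand has a quotient of `p` that needs one
  -- step less, and in the second `at0 v p` is free of `v`, so all further quotients fall on `q`.
  quot^-⊗ : ∀ d e v p q → quot^ d v p ≃ con A.0# → quot^ e v q ≃ con A.0# →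
            quot^ (d ℕ+ e) v (p ⊗ q) ≃ con A.0#
  quot^-⊗ zero    e v p q p≃0 q≃0 =
    quot^-zero e v (≃-trans (⊗-cong p≃0 ≃-refl) (⊗-zeroˡ q))
  quot^-⊗ (suc d) e v p q p≃0 q≃0 = begin
    quot^ (d ℕ+ e) v (quot v p ⊗ q ⊕ at0 v p ⊗ quot v q)
      ≈⟨ quot^-⊕ (d ℕ+ e) v _ _ ⟩
    quot^ (d ℕ+ e) v (quot v p ⊗ q) ⊕ quot^ (d ℕ+ e) v (at0 v p ⊗ quot v q)
      ≈⟨ ⊕-cong (quot^-⊗ d e v (quot v p) q p≃0 q≃0) (quot^-at0-⊗ (d ℕ+ e) v p (quot v q)) ⟩
    con A.0# ⊕ at0 v p ⊗ quot^ (suc d ℕ+ e) v q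
      ≈⟨ ⊕-idˡ _ ⟩
    at0 v p ⊗ quot^ (suc d ℕ+ e) v q
      ≈⟨ ⊗-cong ≃-refl (quot^-+′ (suc d) e v q≃0) ⟩
    at0 v p ⊗ con A.0#
      ≈⟨ ⊗-zeroʳ _ ⟩
    con A.0# ∎

  -- The number `d` stands in for a strict bound on the degree in `v`; it is the fuel of the zero
  -- test below.
  quot-nilpotent : ∀ v p → Σ ℕ λ d → quot^ d v p ≃ con A.0#
  quot-nilpotent v (con a) = 1 , ≃-refl
  quot-nilpotent v (var w) with w ≟ v in eq
  ... | yes _ = 2 , lemma
    where
    lemma : quot v (quot v (var w)) ≃ con A.0#
    lemma rewrite eq = ≃-refl
  ... | no _  = 1 , lemma
    where
    lemma : quot v (var w) ≃ con A.0#
    lemma rewrite eq = ≃-refl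
  quot-nilpotent v (p ⊕ q) with quot-nilpotent v p | quot-nilpotent v q
  ... | d , p≃0 | e , q≃0 = d ℕ+ e ,
    ≃-trans (quot^-⊕ (d ℕ+ e) v p q)
      (≃-trans (⊕-cong (quot^-+ d e v p≃0) (quot^-+′ d e v q≃0)) (⊕-idˡ _))
  quot-nilpotent v (p ⊗ q) with quot-nilpotent v p | quot-nilpotent v q
  ... | d , p≃0 | e , q≃0 = d ℕ+ e , quot^-⊗ d e v p q p≃0 q≃0

  -- `quot v` is a left inverse of multiplication by `var v`.
  var-cancellable : ∀ v → Cancellable (var v)
  var-cancellable v p vp≃0 = ≃-trans (≃-sym (quot-var-⊗ v p)) (quot-cong v vp≃0)

-- The rational numbers inside a field of characteristic zero.

-- The evidence `Scalar` makes a zero test possible where the whole ring has none. `zero?` returns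
-- an inverse that is again a scalar, so that pivoting does not leave the subfield.
record DiscreteSubfield {c ℓ} (R : CommutativeRing c ℓ) q : Set (c ⊔ ℓ ⊔ lsuc q) where
  open CommutativeRing R
  field
    Scalar   : Pred Carrier q
    0-closed : Scalar 0#
    1-closed : Scalar 1#
    +-closed : ∀ {x y} → Scalar x → Scalar y → Scalar (x + y)
    *-closed : ∀ {x y} → Scalar x → Scalar y → Scalar (x * y)
    -‿closed : ∀ {x} → Scalar x → Scalar (- x)
    zero?    : ∀ {x} → Scalar x → x ≈ 0# ⊎ Σ Carrier λ x⁻¹ → Scalar x⁻¹ × x⁻¹ * x ≈ 1#

module Rationals {c ℓ} (R : CommutativeRing c ℓ) where
  open CommutativeRing R hiding (zero)
  open RingProperties ring using (+-cancelʳ; -‿distribˡ-*; -‿distribʳ-*)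
  open SemiringMult semiring using (×-homo-+; ×1-homo-*; ×-homo-1) renaming (_×_ to _·_)
  open SemiringSolver commutativeSemiring using (solve; _:+_; _:*_; _:=_)
  open SetoidReasoning setoid

  ⟦_⟧ : ℕ → Carrier
  ⟦ m ⟧ = m · 1#

  ⟦⟧-homo : ∀ i j k l → ⟦ i ℕ* j ℕ+ k ℕ* l ⟧ ≈ ⟦ i ⟧ * ⟦ j ⟧ + ⟦ k ⟧ * ⟦ l ⟧
  ⟦⟧-homo i j k l =
    trans (×-homo-+ 1# (i ℕ* j) (k ℕ* l)) (+-cong (×1-homo-* i j) (×1-homo-* k l))

  -- x = (a − b) / (q + 1)
  Rational : Pred Carrier ℓ
  Rational x = Σ ℕ λ q → Σ ℕ λ a → Σ ℕ λ b → ⟦ suc q ⟧ * x + ⟦ b ⟧ ≈ ⟦ a ⟧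

  ⟦⟧-rational : ∀ m → Rational ⟦ m ⟧
  ⟦⟧-rational m = 0 , m , 0 ,
    trans (+-identityʳ _) (trans (*-congʳ (×-homo-1 1#)) (*-identityˡ _))

  1-rational : Rational 1#
  1-rational = 0 , 1 , 0 , trans (+-identityʳ _) (*-identityʳ _)

  +-rational : ∀ {x y} → Rational x → Rational y → Rational (x + y)
  +-rational {x} {y} (q , a , b , eq) (q′ , a′ , b′ , eq′) =
    -- The first component is the predecessor of the common denominator: `suc` of it is
    -- `suc q ℕ* suc q′` by computation.
    q′ ℕ+ q ℕ* suc q′ , a ℕ* suc q′ ℕ+ suc q ℕ* a′ , b ℕ* suc q′ ℕ+ suc q ℕ* b′ , (begin
    ⟦ suc q ℕ* suc q′ ⟧ * (x + y) + ⟦ b ℕ* suc q′ ℕ+ suc q ℕ* b′ ⟧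
      ≈⟨ +-cong (*-congʳ (×1-homo-* (suc q) (suc q′))) (⟦⟧-homo b (suc q′) (suc q) b′) ⟩
    (⟦ suc q ⟧ * ⟦ suc q′ ⟧) * (x + y) + (⟦ b ⟧ * ⟦ suc q′ ⟧ + ⟦ suc q ⟧ * ⟦ b′ ⟧)
      ≈⟨ solve 6 (λ m m′ x y b b′ → (m :* m′) :* (x :+ y) :+ (b :* m′ :+ m :* b′) :=
           (m :* x :+ b) :* m′ :+ m :* (m′ :* y :+ b′)) refl _ _ _ _ _ _ ⟩
    (⟦ suc q ⟧ * x + ⟦ b ⟧) * ⟦ suc q′ ⟧ + ⟦ suc q ⟧ * (⟦ suc q′ ⟧ * y + ⟦ b′ ⟧)
      ≈⟨ +-cong (*-congʳ eq) (*-congˡ eq′) ⟩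
    ⟦ a ⟧ * ⟦ suc q′ ⟧ + ⟦ suc q ⟧ * ⟦ a′ ⟧
      ≈⟨ ⟦⟧-homo a (suc q′) (suc q) a′ ⟨
    ⟦ a ℕ* suc q′ ℕ+ suc q ℕ* a′ ⟧ ∎)

  *-rational : ∀ {x y} → Rational x → Rational y → Rational (x * y)
  *-rational {x} {y} (q , a , b , eq) (q′ , a′ , b′ , eq′) =
    q′ ℕ+ q ℕ* suc q′ , a ℕ* a′ ℕ+ b ℕ* b′ , a ℕ* b′ ℕ+ b ℕ* a′ , (begin
    ⟦ suc q ℕ* suc q′ ⟧ * (x * y) + ⟦ a ℕ* b′ ℕ+ b ℕ* a′ ⟧
      ≈⟨ +-cong (*-congʳ (×1-homo-* (suc q) (suc q′))) (⟦⟧-homo a b′ b a′) ⟩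
    (⟦ suc q ⟧ * ⟦ suc q′ ⟧) * (x * y) + (⟦ a ⟧ * ⟦ b′ ⟧ + ⟦ b ⟧ * ⟦ a′ ⟧)
      ≈⟨ +-congˡ (+-cong (*-congʳ eq) (*-congˡ eq′)) ⟨
    (⟦ suc q ⟧ * ⟦ suc q′ ⟧) * (x * y) +
      ((⟦ suc q ⟧ * x + ⟦ b ⟧) * ⟦ b′ ⟧ + ⟦ b ⟧ * (⟦ suc q′ ⟧ * y + ⟦ b′ ⟧))
      ≈⟨ solve 6 (λ m m′ x y b b′ →
           (m :* m′) :* (x :* y) :+ ((m :* x :+ b) :* b′ :+ b :* (m′ :* y :+ b′)) :=
           (m :* x :+ b) :* (m′ :* y :+ b′) :+ b :* b′) refl _ _ _ _ _ _ ⟩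
    (⟦ suc q ⟧ * x + ⟦ b ⟧) * (⟦ suc q′ ⟧ * y + ⟦ b′ ⟧) + ⟦ b ⟧ * ⟦ b′ ⟧
      ≈⟨ +-congʳ (*-cong eq eq′) ⟩
    ⟦ a ⟧ * ⟦ a′ ⟧ + ⟦ b ⟧ * ⟦ b′ ⟧
      ≈⟨ ⟦⟧-homo a a′ b b′ ⟨
    ⟦ a ℕ* a′ ℕ+ b ℕ* b′ ⟧ ∎)

  -‿rational : ∀ {x} → Rational x → Rational (- x)
  -‿rational {x} (q , a , b , eq) = q , b , a , (begin
    ⟦ suc q ⟧ * (- x) + ⟦ a ⟧                     ≈⟨ +-congˡ eq ⟨
    ⟦ suc q ⟧ * (- x) + (⟦ suc q ⟧ * x + ⟦ b ⟧)   ≈⟨ solve 4 (λ m n x b →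
                                                       m :* n :+ (m :* x :+ b) := m :* (n :+ x) :+ b)
                                                       refl _ _ _ _ ⟩
    ⟦ suc q ⟧ * (- x + x) + ⟦ b ⟧                 ≈⟨ +-congʳ (trans (*-congˡ (-‿inverseˡ x)) (zeroʳ _)) ⟩
    0# + ⟦ b ⟧                                    ≈⟨ +-identityˡ _ ⟩
    ⟦ b ⟧                                         ∎)

  module _ (invertible : ∀ m → Σ Carrier λ y → y * ⟦ suc m ⟧ ≈ 1#) where

    private
      Inverse : Carrier → Set _
      Inverse x = Σ Carrier λ x⁻¹ → Rational x⁻¹ × x⁻¹ * x ≈ 1#

      -- Here x = (d + 1) / (q + 1), so the inverse is (q + 1) / (d + 1), with `y` for the
      -- reciprocal of the new denominator.
      inverse-of-positive : ∀ q b d {x} → ⟦ suc q ⟧ * x + ⟦ b ⟧ ≈ ⟦ suc (b ℕ+ d) ⟧ → Inverse x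
      inverse-of-positive q b d {x} eq with invertible d
      ... | y , yd≈1 = y * ⟦ suc q ⟧ , (d , suc q , 0 , rational) , inverse
        where
        rational : ⟦ suc d ⟧ * (y * ⟦ suc q ⟧) + ⟦ 0 ⟧ ≈ ⟦ suc q ⟧
        rational = begin
          ⟦ suc d ⟧ * (y * ⟦ suc q ⟧) + ⟦ 0 ⟧ ≈⟨ +-identityʳ _ ⟩
          ⟦ suc d ⟧ * (y * ⟦ suc q ⟧)         ≈⟨ solve 3 (λ d y q → d :* (y :* q) := (y :* d) :* q)
                                                   refl _ _ _ ⟩
          (y * ⟦ suc d ⟧) * ⟦ suc q ⟧         ≈⟨ *-congʳ yd≈1 ⟩
          1# * ⟦ suc q ⟧                      ≈⟨ *-identityˡ _ ⟩
          ⟦ suc q ⟧                           ∎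
        inverse : (y * ⟦ suc q ⟧) * x ≈ 1#
        inverse = begin
          (y * ⟦ suc q ⟧) * x   ≈⟨ *-assoc _ _ _ ⟩
          y * (⟦ suc q ⟧ * x)   ≈⟨ *-congˡ (+-cancelʳ ⟦ b ⟧ _ _ (trans eq (trans
                                    (+-congˡ (trans (×-homo-+ 1# b d) (+-comm _ _)))
                                    (sym (+-assoc _ _ _))))) ⟩
          y * ⟦ suc d ⟧         ≈⟨ yd≈1 ⟩
          1#                    ∎

    -- The numerator is a difference of natural numbers, so comparing `a` with `b` decides the case;
    -- a negative numerator is handled through `- x`.
    rational-zero? : ∀ {x} → Rational x → x ≈ 0# ⊎ Inverse x
    rational-zero? {x} x∈@(q , a , b , eq) with compare a b
    ... | greater b d = inj₂ (inverse-of-positive q b d eq)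
    ... | less a d    = inj₂ (neg (inverse-of-positive q a d
                                  (proj₂ (proj₂ (proj₂ (-‿rational x∈))))))
      where
      neg : Inverse (- x) → Inverse x
      neg (y , y∈ , y*-x≈1) = - y , -‿rational y∈ ,
        trans (sym (-‿distribˡ-* y x)) (trans (-‿distribʳ-* y x) y*-x≈1)
    ... | equal a with invertible q
    ...   | y , yq≈1 = inj₁ (begin
      x                     ≈⟨ *-identityˡ x ⟨
      1# * x                ≈⟨ *-congʳ yq≈1 ⟨
      (y * ⟦ suc q ⟧) * x   ≈⟨ *-assoc _ _ _ ⟩
      y * (⟦ suc q ⟧ * x)   ≈⟨ *-congˡ (+-cancelʳ ⟦ a ⟧ _ _ (trans eq (sym (+-identityˡ _)))) ⟩
      y * 0#                ≈⟨ zeroʳ y ⟩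
      0#                    ∎)

    rationals : DiscreteSubfield R ℓ
    rationals = record
      { Scalar = Rational ; 0-closed = ⟦⟧-rational 0 ; 1-closed = 1-rational
      ; +-closed = +-rational ; *-closed = *-rational ; -‿closed = -‿rational
      ; zero? = rational-zero? }

primeField : ∀ {c ℓ₁ ℓ₂} (K : HeytingField c ℓ₁ ℓ₂) → CharacteristicZero K →
             DiscreteSubfield (commutativeRing K) ℓ₁
primeField K char0 = Rationals.rationals (commutativeRing K) λ m →
  let y , yx≈1 , _ = #⇒invertible (char0 m) in
  -- Apartness from zero inverts the difference of the element and `0#`, which has to be rewritten
  -- as the element itself.
  y , trans (*-congˡ (sym (trans (+-congˡ -0#≈0#) (+-identityʳ _)))) yx≈1
  where
  open HeytingField K using (#⇒invertible)
  open CommutativeRing (commutativeRing K)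
  open RingProperties ring using (-0#≈0#)

-- Linear algebra in the polynomial ring: spans, zero test, elimination.

module Combinations {c ℓ v} (R : CommutativeRing c ℓ) (V : Set v) where
  private
    module R = CommutativeRing R
    P = Poly R.Carrier V
  open PolynomialRing R V
  open BigOperators polySemiring
  open BigOperatorProperties polySemiring
  open SemiringSum (CommutativeSemiring.semiring polySemiring)
    using (∑-distrib-+; *-distribˡ-sum)
  open SemiringSolver polySemiring using (solve; _:+_; _:*_; _:=_)
  open SetoidReasoning (CommutativeSemiring.setoid polySemiring)

  comb : ∀ {m} → (Fin m → R.Carrier) → (Fin m → P) → P
  comb λs b = ∑ λ a → con (λs a) ⊗ b a

  Independent : ∀ {m} → (Fin m → P) → Set _
  Independent b = ∀ λs → comb λs b ≃ con R.0# → ∀ a → λs a R.≈ R.0#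

  InSpan : ∀ {m} → (Fin m → P) → P → Set _
  InSpan b p = Σ _ λ λs → p ≃ comb λs b

  comb-+ : ∀ {m} λs μs (b : Fin m → P) → comb (λ a → λs a R.+ μs a) b ≃ comb λs b ⊕ comb μs b
  comb-+ λs μs b = ≃-trans
    (∑-cong _ (λ a → con (λs a) ⊗ b a ⊕ con (μs a) ⊗ b a)
      λ a → ≃-trans (⊗-cong (con-+ _ _) ≃-refl) (distribʳ _ _ _))
    (∑-distrib-+ (λ a → con (λs a) ⊗ b a) (λ a → con (μs a) ⊗ b a))

  comb-⊗ : ∀ {m} p λs (b : Fin m → P) → p ⊗ comb λs b ≃ comb λs (λ a → p ⊗ b a)
  comb-⊗ p λs b = ≃-trans (*-distribˡ-sum p (λ a → con (λs a) ⊗ b a)) (∑-cong _ _ λ a →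
    solve 3 (λ p l b → p :* (l :* b) := l :* (p :* b)) ≃-refl p (con (λs a)) (b a))

  comb-scale : ∀ {m} s λs (b : Fin m → P) → con s ⊗ comb λs b ≃ comb (λ a → s R.* λs a) b
  comb-scale s λs b = ≃-trans (*-distribˡ-sum (con s) (λ a → con (λs a) ⊗ b a))
    (∑-cong (λ a → con s ⊗ (con (λs a) ⊗ b a)) (λ a → con (s R.* λs a) ⊗ b a)
      λ a → ≃-trans (≃-sym (⊗-assoc _ _ _)) (⊗-cong (≃-sym (con-* _ _)) ≃-refl))

  comb-zero : ∀ {m} λs {b : Fin m → P} → (∀ a → b a ≃ con R.0#) → comb λs b ≃ con R.0#
  comb-zero λs b≃0 = ∑-zero _ λ a → ≃-trans (⊗-cong ≃-refl (b≃0 a)) (⊗-zeroʳ _)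

  InSpan-cong : ∀ {m} {b : Fin m → P} {p q} → p ≃ q → InSpan b q → InSpan b p
  InSpan-cong p≃q (λs , eq) = λs , ≃-trans p≃q eq

  InSpan-zero : ∀ {m} {b : Fin m → P} → InSpan b (con R.0#)
  InSpan-zero {b = b} = (λ _ → R.0#) , ≃-sym (∑-zero (λ a → con R.0# ⊗ b a) λ a → ⊗-zeroˡ (b a))

  InSpan-comb : ∀ {m k} {b : Fin m → P} (μs : Fin k → R.Carrier) d →
                (∀ a → InSpan b (d a)) → InSpan b (comb μs d)
  InSpan-comb {k = zero}  μs d d∈ = InSpan-zero
  InSpan-comb {k = suc k} {b} μs d d∈
    with d∈ zero | InSpan-comb (μs ∘ suc) (d ∘ suc) (d∈ ∘ suc)
  ... | λs , eq | νs , eq′ = (λ a → μs zero R.* λs a R.+ νs a) ,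
    ≃-trans (⊕-cong (≃-trans (⊗-cong ≃-refl eq) (comb-scale (μs zero) λs b)) eq′)
            (≃-sym (comb-+ _ _ b))

  InSpan-element : ∀ {m} (b : Fin m → P) a → InSpan b (b a)
  InSpan-element b zero    = (R.1# ◂ proj₁ (InSpan-zero {b = b ∘ suc})) ,
    ≃-trans (≃-sym (⊕-idʳ _)) (⊕-cong (≃-sym (⊗-idˡ _)) (proj₂ (InSpan-zero {b = b ∘ suc})))
  InSpan-element b (suc a) with InSpan-element (b ∘ suc) a
  ... | λs , eq = (R.0# ◂ λs) ,
    ≃-trans eq (≃-trans (≃-sym (⊕-idˡ _)) (⊕-cong (≃-sym (⊗-zeroˡ _)) ≃-refl))

  InSpan-suc : ∀ {m} (b : Fin (suc m) → P) {p} → InSpan (b ∘ suc) p → InSpan b p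
  InSpan-suc b (λs , eq) = InSpan-cong {b = b} eq
    (InSpan-comb {b = b} λs (b ∘ suc) (λ a → InSpan-element b (suc a)))

  record IsLinear (L : P → P) : Set (c ⊔ ℓ ⊔ v) where
    field
      cong    : ∀ {p q} → p ≃ q → L p ≃ L q
      ⊕-homo  : ∀ p q → L (p ⊕ q) ≃ L p ⊕ L q
      ⊗-scale : ∀ a p → L (con a ⊗ p) ≃ con a ⊗ L p

    0-homo : L (con R.0#) ≃ con R.0#
    0-homo = ≃-trans (cong (≃-sym (⊗-zeroˡ (con R.0#))))
      (≃-trans (⊗-scale _ _) (⊗-zeroˡ _))

    comb-homo : ∀ {m} λs (b : Fin m → P) → L (comb λs b) ≃ comb λs (L ∘ b)
    comb-homo {zero}  λs b = 0-homo
    comb-homo {suc m} λs b = ≃-trans (⊕-homo _ _)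
      (⊕-cong (⊗-scale _ _) (comb-homo (λs ∘ suc) (b ∘ suc)))

  eval-isLinear : ∀ ρ → IsLinear (eval polySemiring con ρ)
  eval-isLinear ρ = record
    { cong = Evaluation.eval-cong R.commutativeSemiring polySemiring
               (Constants.con-isSemiringHomomorphism R.commutativeSemiring V) ρ
    ; ⊕-homo = λ _ _ → ≃-refl ; ⊗-scale = λ _ _ → ≃-refl }

module Elimination {c ℓ q v} (R : CommutativeRing c ℓ) (F : DiscreteSubfield R q) {V : Set v}
                   (_≟_ : DecidableEquality V)
                   (variables : List V) (complete : ∀ x → x ∈ᴸ variables) where
  private
    module R = CommutativeRing R
    P = Poly R.Carrier V
  open DiscreteSubfield F
  open PolynomialRing R V
  open Combinations R V
  open Division R.commutativeSemiring _≟_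
  open SemiringSolver polySemiring using (solve; _:+_; _:*_; _:=_)
  open SetoidReasoning (CommutativeSemiring.setoid polySemiring)
  open RingProperties R.ring using (-‿+-comm; -‿distribʳ-*; -0#≈0#)

  -- A condition on the expression and not on its class modulo `_≃_`. Hence every map used in the
  -- elimination carries its own proof of preserving it.
  Over : P → Set q
  Over (con a) = Scalar a
  Over (var x) = ⊤
  Over (p ⊕ r) = Over p × Over r
  Over (p ⊗ r) = Over p × Over r

  eval-over : ∀ {ρ} → (∀ x → Over (ρ x)) → ∀ p → Over p → Over (eval polySemiring con ρ p)
  eval-over ρ∈ (con a) a∈        = a∈
  eval-over ρ∈ (var x) _         = ρ∈ x
  eval-over ρ∈ (p ⊕ r) (p∈ , r∈) = eval-over ρ∈ p p∈ , eval-over ρ∈ r r∈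
  eval-over ρ∈ (p ⊗ r) (p∈ , r∈) = eval-over ρ∈ p p∈ , eval-over ρ∈ r r∈

  at0-over : ∀ x p → Over p → Over (at0 x p)
  at0-over x = eval-over λ w → lemma w
    where
    lemma : ∀ w → Over (if does (w ≟ x) then con R.0# else var w)
    lemma w with w ≟ x
    ... | yes _ = 0-closed
    ... | no _  = tt

  quot-over : ∀ x p → Over p → Over (quot x p)
  quot-over x (con a) _ = 0-closed
  quot-over x (var w) _ with w ≟ x
  ... | yes _ = 1-closed
  ... | no _  = 0-closed
  quot-over x (p ⊕ r) (p∈ , r∈) = quot-over x p p∈ , quot-over x r r∈
  quot-over x (p ⊗ r) (p∈ , r∈) =
    (quot-over x p p∈ , r∈) , (at0-over x p p∈ , quot-over x r r∈)

  record LinearMap : Set (c ⊔ ℓ ⊔ q ⊔ v) where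
    field
      map      : P → P
      isLinear : IsLinear map
      over     : ∀ p → Over p → Over (map p)
    open IsLinear isLinear public

  identity : LinearMap
  identity = record { map = id ; over = λ _ p∈ → p∈
    ; isLinear = record { cong = id ; ⊕-homo = λ _ _ → ≃-refl ; ⊗-scale = λ _ _ → ≃-refl } }

  _after-quot_ : LinearMap → V → LinearMap
  L after-quot x = record
    { map = λ p → map (quot x p)
    ; over = λ p p∈ → over _ (quot-over x p p∈)
    ; isLinear = record
      { cong = λ e → cong (quot-cong x e)
      ; ⊕-homo = λ _ _ → ⊕-homo _ _
      ; ⊗-scale = λ a p → ≃-trans
          (cong (≃-trans (⊕-cong (⊗-zeroˡ p) ≃-refl) (⊕-idˡ _))) (⊗-scale a _) } }
    where open LinearMap L

  constantTerm : P → R.Carrier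
  constantTerm = eval R.commutativeSemiring id (λ _ → R.0#)

  constantTerm-cong : ∀ {p r} → p ≃ r → constantTerm p R.≈ constantTerm r
  constantTerm-cong = Evaluation.eval-cong R.commutativeSemiring R.commutativeSemiring
    (Identity.isSemiringHomomorphism _ R.refl) _

  constantTerm-scalar : ∀ p → Over p → Scalar (constantTerm p)
  constantTerm-scalar (con a) a∈        = a∈
  constantTerm-scalar (var x) _         = 0-closed
  constantTerm-scalar (p ⊕ r) (p∈ , r∈) =
    +-closed (constantTerm-scalar p p∈) (constantTerm-scalar r r∈)
  constantTerm-scalar (p ⊗ r) (p∈ , r∈) =
    *-closed (constantTerm-scalar p p∈) (constantTerm-scalar r r∈)

  allAt0 : List V → P → P
  allAt0 []       p = p
  allAt0 (x ∷ xs) p = allAt0 xs (at0 x p)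

  allAt0-cong : ∀ xs {p r} → p ≃ r → allAt0 xs p ≃ allAt0 xs r
  allAt0-cong []       e = e
  allAt0-cong (x ∷ xs) e = allAt0-cong xs (at0-cong x e)

  allAt0-con : ∀ xs a → allAt0 xs (con a) ≃ con a
  allAt0-con []       a = ≃-refl
  allAt0-con (x ∷ xs) a = allAt0-con xs a

  allAt0-⊕ : ∀ xs p r → allAt0 xs (p ⊕ r) ≃ allAt0 xs p ⊕ allAt0 xs r
  allAt0-⊕ []       p r = ≃-refl
  allAt0-⊕ (x ∷ xs) p r = allAt0-⊕ xs _ _

  allAt0-⊗ : ∀ xs p r → allAt0 xs (p ⊗ r) ≃ allAt0 xs p ⊗ allAt0 xs r
  allAt0-⊗ []       p r = ≃-refl
  allAt0-⊗ (x ∷ xs) p r = allAt0-⊗ xs _ _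

  allAt0-var : ∀ xs {x} → x ∈ᴸ xs → allAt0 xs (var x) ≃ con R.0#
  allAt0-var (w ∷ xs) {x} x∈ with x ≟ w | x∈
  ... | yes _  | _           = allAt0-con xs _
  ... | no x≢w | here x≡w    = contradiction x≡w x≢w
  ... | no _   | there x∈xs  = allAt0-var xs x∈xs

  allAt0-constantTerm : ∀ xs → (∀ x → x ∈ᴸ xs) → ∀ p → allAt0 xs p ≃ con (constantTerm p)
  allAt0-constantTerm xs all (con a) = allAt0-con xs a
  allAt0-constantTerm xs all (var x) = allAt0-var xs (all x)
  allAt0-constantTerm xs all (p ⊕ r) = ≃-trans (allAt0-⊕ xs p r) (≃-trans
    (⊕-cong (allAt0-constantTerm xs all p) (allAt0-constantTerm xs all r)) (≃-sym (con-+ _ _)))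
  allAt0-constantTerm xs all (p ⊗ r) = ≃-trans (allAt0-⊗ xs p r) (≃-trans
    (⊗-cong (allAt0-constantTerm xs all p) (allAt0-constantTerm xs all r)) (≃-sym (con-* _ _)))

  -- The witness built below is an iterated quotient by variables; followed by `constantTerm` it
  -- reads off one coefficient of `p`, and this coefficient is invertible.
  record Nonzero (p : P) : Set (c ⊔ ℓ ⊔ q ⊔ v) where
    field
      coefficient    : LinearMap
      inverse        : R.Carrier
      inverse-scalar : Scalar inverse
      isInverse      : inverse R.* constantTerm (LinearMap.map coefficient p) R.≈ R.1#

  private
    -- xs are the variables still to be eliminated, ys those already set to zero.
    zeroAt? : ∀ xs ys → (∀ x → x ∈ᴸ xs ⊎ x ∈ᴸ ys) → ∀ p → Over p →
              allAt0 ys p ≃ con R.0# ⊎ Nonzero p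
    zeroAt? [] ys all p p∈ with zero? (constantTerm-scalar p p∈)
    ... | inj₁ p≈0 = inj₁ (≃-trans (allAt0-constantTerm ys all′ p) (con-cong p≈0))
      where
      all′ : ∀ x → x ∈ᴸ ys
      all′ x with all x
      ... | inj₂ x∈ys = x∈ys
    ... | inj₂ (u , u∈ , up≈1) = inj₂ (record
      { coefficient = identity ; inverse = u ; inverse-scalar = u∈ ; isInverse = up≈1 })
    zeroAt? (x ∷ xs) ys all p p∈ = go (proj₁ (quot-nilpotent x p)) p p∈ (proj₂ (quot-nilpotent x p))
      where
      all′ : ∀ w → w ∈ᴸ xs ⊎ w ∈ᴸ (x ∷ ys)
      all′ w with all w
      ... | inj₁ (here w≡x)   = inj₂ (here w≡x)
      ... | inj₁ (there w∈xs) = inj₁ w∈xs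
      ... | inj₂ w∈ys         = inj₂ (there w∈ys)

      -- Runs through the coefficients of the powers of `x`, testing each with `x` added to the
      -- variables set to zero. If all of them vanish, `at0-quot` puts `p` together again as zero.
      go : ∀ d p → Over p → quot^ d x p ≃ con R.0# → allAt0 ys p ≃ con R.0# ⊎ Nonzero p
      go zero p p∈ p≃0 = inj₁ (≃-trans (allAt0-cong ys p≃0) (allAt0-con ys _))
      go (suc d) p p∈ eq with zeroAt? xs (x ∷ ys) all′ p p∈
      ... | inj₂ nz   = inj₂ nz
      ... | inj₁ z≃0 with go d (quot x p) (quot-over x p p∈) eq
      ...   | inj₂ nz = inj₂ (record
                { coefficient = Nonzero.coefficient nz after-quot x
                ; inverse = Nonzero.inverse nz
                ; inverse-scalar = Nonzero.inverse-scalar nz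
                ; isInverse = Nonzero.isInverse nz })
      ...   | inj₁ q≃0 = inj₁ (begin
        allAt0 ys p
          ≈⟨ allAt0-cong ys (at0-quot x p) ⟩
        allAt0 ys (at0 x p ⊕ var x ⊗ quot x p)
          ≈⟨ allAt0-⊕ ys _ _ ⟩
        allAt0 ys (at0 x p) ⊕ allAt0 ys (var x ⊗ quot x p)
          ≈⟨ ⊕-cong z≃0 (≃-trans (allAt0-⊗ ys _ _) (≃-trans (⊗-cong ≃-refl q≃0) (⊗-zeroʳ _))) ⟩
        con R.0# ⊕ con R.0#
          ≈⟨ ⊕-idˡ _ ⟩
        con R.0# ∎)

  isZero? : ∀ p → Over p → p ≃ con R.0# ⊎ Nonzero p
  isZero? = zeroAt? variables [] (λ x → inj₁ (complete x))

  -- Elimination recorded as a projection: `π` kills the span of `b` and changes `p` only by an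
  -- element of that span. So `p` lies in the span exactly when `π p` vanishes, which reduces
  -- membership to `isZero?`.
  record Complemented {m} (b : Fin m → P) : Set (c ⊔ ℓ ⊔ q ⊔ v) where
    field
      projection  : LinearMap
      independent : Independent b
    open LinearMap projection public renaming (map to π)
    field
      kills      : ∀ a → π (b a) ≃ con R.0#
      decomposes : ∀ p → Σ _ λ λs → p ≃ π p ⊕ comb λs b

  empty : (b : Fin 0 → P) → Complemented b
  empty b = record { projection = identity ; independent = λ _ _ () ; kills = λ ()
    ; decomposes = λ p → (λ ()) , ≃-sym (⊕-idʳ p) }

  module _ {m} (b : Fin (suc m) → P) (C : Complemented (b ∘ suc))
           (nz : Nonzero (Complemented.π C (b zero))) (g∈ : Over (b zero)) where
    private
      open Complemented C
      open Nonzero nz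
      module L = LinearMap coefficient
      g = b zero

      -- The functional that is one on the pivot `g` and zero on the older vectors. Subtracting
      -- `ψ p` times `π g` is the elimination step.
      ψ : P → R.Carrier
      ψ p = inverse R.* constantTerm (L.map (π p))

      ψ-cong : ∀ {p r} → p ≃ r → ψ p R.≈ ψ r
      ψ-cong e = R.*-congˡ (constantTerm-cong (L.cong (cong e)))

      ψ-⊕ : ∀ p r → ψ (p ⊕ r) R.≈ ψ p R.+ ψ r
      ψ-⊕ p r = R.trans
        (R.*-congˡ (constantTerm-cong (≃-trans (L.cong (⊕-homo p r)) (L.⊕-homo _ _))))
        (R.distribˡ _ _ _)

      ψ-⊗ : ∀ a p → ψ (con a ⊗ p) R.≈ a R.* ψ p
      ψ-⊗ a p = R.trans
        (R.*-congˡ (constantTerm-cong (≃-trans (L.cong (⊗-scale a p)) (L.⊗-scale _ _))))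
        (x∙yz≈y∙xz _ _ _)
        where open CommutativeSemigroupProperties R.*-commutativeSemigroup using (x∙yz≈y∙xz)

      ψ-kills : ∀ a → ψ (b (suc a)) R.≈ R.0#
      ψ-kills a = R.trans
        (R.*-congˡ (constantTerm-cong (≃-trans (L.cong (kills a)) L.0-homo))) (R.zeroʳ _)

      π′ : P → P
      π′ p = π p ⊕ con (R.- ψ p) ⊗ π g

      decomposes′ : ∀ p → Σ _ λ λs → p ≃ π′ p ⊕ comb λs b
      decomposes′ p with decomposes p | decomposes g
      ... | λs , p≃ | μs , g≃ = (ψ p ◂ λ a → λs a R.+ (R.- ψ p) R.* μs a) , (begin
        p
          ≈⟨ p≃ ⟩
        π p ⊕ comb λs b′
          -- Inserts `ψ p − ψ p` times `g`: one half becomes the coefficient of `g`, the other, with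
          -- `g` decomposed, corrects `π p` to `π′ p`.
          ≈⟨ ⊕-cong ≃-refl (≃-trans (≃-sym (⊕-idʳ _)) (⊕-cong ≃-refl (≃-sym (⊗-zeroˡ g)))) ⟩
        π p ⊕ (comb λs b′ ⊕ con R.0# ⊗ g)
          ≈⟨ ⊕-cong ≃-refl (⊕-cong ≃-refl (⊗-cong
               (≃-trans (con-cong (R.sym (R.-‿inverseʳ (ψ p)))) (con-+ _ _)) ≃-refl)) ⟩
        π p ⊕ (comb λs b′ ⊕ (s ⊕ t) ⊗ g)
          ≈⟨ ⊕-cong ≃-refl (⊕-cong ≃-refl
               (≃-trans (distribʳ _ _ _) (⊕-cong ≃-refl (⊗-cong ≃-refl g≃)))) ⟩
        π p ⊕ (comb λs b′ ⊕ (s ⊗ g ⊕ t ⊗ (π g ⊕ comb μs b′)))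
          ≈⟨ solve 7 (λ x l s g t y z →
               x :+ (l :+ (s :* g :+ t :* (y :+ z))) := (x :+ t :* y) :+ (s :* g :+ (l :+ t :* z)))
             ≃-refl (π p) (comb λs b′) s g t (π g) (comb μs b′) ⟩
        π′ p ⊕ (s ⊗ g ⊕ (comb λs b′ ⊕ t ⊗ comb μs b′))
          ≈⟨ ⊕-cong ≃-refl (⊕-cong ≃-refl (≃-trans
               (⊕-cong ≃-refl (comb-scale (R.- ψ p) μs b′)) (≃-sym (comb-+ _ _ b′)))) ⟩
        π′ p ⊕ (s ⊗ g ⊕ comb (λ a → λs a R.+ (R.- ψ p) R.* μs a) b′) ∎)
        where
        b′ = b ∘ suc
        s = con (ψ p)
        t = con (R.- ψ p)

      -- `π` removes the tail of the relation, and `ψ` of what is left is the head coefficient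
      -- because `ψ g` is one.
      head-zero : ∀ λs → comb λs b ≃ con R.0# → λs zero R.≈ R.0#
      head-zero λs eq = R.trans (R.sym (R.*-identityʳ _))
        (R.trans (R.*-congˡ (R.sym isInverse))
        (R.trans (R.sym (ψ-⊗ (λs zero) g))
        (R.trans (R.*-congˡ (constantTerm-cong (L.cong kernel)))
        (R.trans (R.*-congˡ (constantTerm-cong L.0-homo)) (R.zeroʳ _)))))
        where
        kernel : π (con (λs zero) ⊗ g) ≃ con R.0#
        kernel = begin
          π (con (λs zero) ⊗ g)
            ≈⟨ ⊕-idʳ _ ⟨
          π (con (λs zero) ⊗ g) ⊕ con R.0#
            ≈⟨ ⊕-cong ≃-refl (≃-trans (comb-homo (λs ∘ suc) (b ∘ suc)) (comb-zero (λs ∘ suc) kills)) ⟨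
          π (con (λs zero) ⊗ g) ⊕ π (comb (λs ∘ suc) (b ∘ suc))
            ≈⟨ ⊕-homo _ _ ⟨
          π (comb λs b)
            ≈⟨ cong eq ⟩
          π (con R.0#)
            ≈⟨ 0-homo ⟩
          con R.0# ∎

    adjoin : Complemented b
    adjoin = record
      { projection = record
        { map = π′
        ; isLinear = record
          { cong = λ e → ⊕-cong (cong e) (⊗-cong (con-cong (R.-‿cong (ψ-cong e))) ≃-refl)
          ; ⊕-homo = λ p r → ≃-trans
              (⊕-cong (⊕-homo p r) (⊗-cong (≃-trans (con-cong
                (R.trans (R.-‿cong (ψ-⊕ p r)) (R.sym (-‿+-comm _ _)))) (con-+ _ _)) ≃-refl))
              (solve 5 (λ a b s t g → (a :+ b) :+ (s :+ t) :* g := (a :+ s :* g) :+ (b :+ t :* g))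
                ≃-refl _ _ _ _ _)
          ; ⊗-scale = λ a p → ≃-trans
              (⊕-cong (⊗-scale a p) (⊗-cong (≃-trans (con-cong
                (R.trans (R.-‿cong (ψ-⊗ a p)) (-‿distribʳ-* _ _))) (con-* _ _)) ≃-refl))
              (solve 4 (λ a p s g → a :* p :+ (a :* s) :* g := a :* (p :+ s :* g))
                ≃-refl _ _ _ _) }
        ; over = λ p p∈ → over p p∈ ,
            (-‿closed (*-closed inverse-scalar
              (constantTerm-scalar (L.map (π p)) (L.over (π p) (over p p∈)))) , over g g∈) }
      ; independent = λ λs eq → λ where
          zero    → head-zero λs eq
          (suc a) → independent (λs ∘ suc) (≃-trans (≃-trans (≃-sym (⊕-idˡ _))
            (⊕-cong (≃-sym (≃-trans (⊗-cong (con-cong (head-zero λs eq)) ≃-refl) (⊗-zeroˡ _)))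
              ≃-refl)) eq) a
      ; kills = λ where
          zero    → ≃-trans (⊕-cong ≃-refl (⊗-cong (con-cong (R.-‿cong isInverse)) ≃-refl))
                      (⊖-inverseʳ _)
          (suc a) → ≃-trans (⊕-cong (kills a)
                      (≃-trans (⊗-cong (con-cong (R.trans (R.-‿cong (ψ-kills a)) -0#≈0#)) ≃-refl)
                        (⊗-zeroˡ _))) (⊕-idˡ _)
      ; decomposes = decomposes′ }

  adjoin? : ∀ {m} (b : Fin (suc m) → P) → Complemented (b ∘ suc) → Over (b zero) →
            InSpan (b ∘ suc) (b zero) ⊎ Complemented b
  adjoin? b C g∈ with isZero? (π (b zero)) (over _ g∈)
    where open Complemented C
  ... | inj₂ nz   = inj₂ (adjoin b C nz g∈)
  ... | inj₁ πg≃0 with Complemented.decomposes C (b zero)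
  ...   | λs , eq = inj₁ (λs , ≃-trans eq (≃-trans (⊕-cong πg≃0 ≃-refl) (⊕-idˡ _)))

  -- Builds the projection for a family already known to be independent, as the lifts will be: the
  -- other outcome of `adjoin?` would be a relation with head coefficient 1.
  complement : ¬ (R.1# R.≈ R.0#) → ∀ {m} (b : Fin m → P) → (∀ a → Over (b a)) →
               Independent b → Complemented b
  complement 1≉0 {zero}  b b∈ indep = empty b
  complement 1≉0 {suc m} b b∈ indep
    with adjoin? b (complement 1≉0 (b ∘ suc) (b∈ ∘ suc) indep′) (b∈ zero)
    where
    indep′ : Independent (b ∘ suc)
    indep′ λs eq a = indep (R.0# ◂ λs)
      (≃-trans (⊕-cong (⊗-zeroˡ _) eq) (⊕-idˡ _)) (suc a)
  ... | inj₂ C = C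
  ... | inj₁ (λs , eq) = ⊥-elim (1≉0 (indep (R.1# ◂ λ a → (R.- R.1#) R.* λs a)
    (≃-trans (⊕-cong (≃-trans (⊗-idˡ _) eq) (≃-sym (comb-scale (R.- R.1#) λs (b ∘ suc))))
             (⊖-inverseʳ _)) zero))

  module _ {i} {I : Set i} (gen : I → P) (gen-over : ∀ x → Over (gen x)) where

    -- The initial family stays as a tail, and each index put in front comes with its evidence for
    -- `Q`; sums over the final basis can then be split by recursion.
    data Extension {w m} (Q : Pred I w) (js : Fin m → I) : ∀ {m′} → (Fin m′ → I) → Set (i ⊔ w) where
      done : Extension Q js js
      add  : ∀ {m′ x} {ks : Fin m′ → I} → Q x → Extension Q js ks → Extension Q js (x ◂ ks)

    InSpan-extension : ∀ {w m} {Q : Pred I w} {js : Fin m → I} {m′} {ks : Fin m′ → I} →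
      Extension Q js ks → ∀ {p} → InSpan (gen ∘ js) p → InSpan (gen ∘ ks) p
    InSpan-extension done p∈ = p∈
    InSpan-extension (add {x = x} {ks} _ e) p∈ = InSpan-suc (gen ∘ (x ◂ ks)) (InSpan-extension e p∈)

    record Completion {w m} (Q : Pred I w) (js : Fin m → I) (xs : List I) :
           Set (c ⊔ ℓ ⊔ q ⊔ v ⊔ i ⊔ w) where
      field
        {dim}        : ℕ
        indices      : Fin dim → I
        extension    : Extension Q js indices
        complemented : Complemented (gen ∘ indices)
        spans        : ∀ {x} → x ∈ᴸ xs → Q x → InSpan (gen ∘ indices) (gen x)

    complete-basis : ∀ {w m} {Q : Pred I w} → Decidable Q → (js : Fin m → I) →
      Complemented (gen ∘ js) → ∀ xs → Completion Q js xs
    complete-basis Q? js C [] = record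
      { indices = js ; extension = done ; complemented = C ; spans = λ () }
    complete-basis Q? js C (x ∷ xs) with complete-basis Q? js C xs | Q? x
    ... | record { indices = ks ; extension = e ; complemented = C′ ; spans = s } | no ¬Qx = record
      { indices = ks ; extension = e ; complemented = C′
      ; spans = λ { (here ≡.refl) Qx → contradiction Qx ¬Qx ; (there x∈) → s x∈ } }
    ... | record { indices = ks ; extension = e ; complemented = C′ ; spans = s } | yes Qx
      with adjoin? (gen ∘ (x ◂ ks)) C′ (gen-over x)
    ...   | inj₁ x∈ = record
      { indices = ks ; extension = e ; complemented = C′
      ; spans = λ { (here ≡.refl) _ → x∈ ; (there x∈) → s x∈ } }
    ...   | inj₂ C″ = record
      { indices = x ◂ ks ; extension = add Qx e ; complemented = C″
      ; spans = λ { (here ≡.refl) _ → InSpan-element (gen ∘ (x ◂ ks)) zero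
                  ; (there x∈) Qx → InSpan-suc (gen ∘ (x ◂ ks)) (s x∈ Qx) } }

-- Determinants: signs, triangular matrices, expansion along a unit row.

-- The position of s once the column punchIn s j has been deleted.
shift : ∀ {m} → Fin (suc (suc m)) → Fin (suc m) → Fin (suc m)
shift         zero    j       = zero
shift         (suc s) zero    = s
shift {suc m} (suc s) (suc j) = suc (shift s j)

punchIn-shift : ∀ {m} (s : Fin (suc (suc m))) j → punchIn (punchIn s j) (shift s j) ≡ s
punchIn-shift         zero    j       = ≡.refl
punchIn-shift         (suc s) zero    = ≡.refl
punchIn-shift {suc m} (suc s) (suc j) = ≡.cong suc (punchIn-shift s j)

-- Both sides enumerate the columns left after deleting `s` and `punchIn s j`, once in each order.
punchIn-comm : ∀ {m} (s : Fin (suc (suc m))) j i →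
               punchIn (punchIn s j) (punchIn (shift s j) i) ≡ punchIn s (punchIn j i)
punchIn-comm         zero    j       i       = ≡.refl
punchIn-comm         (suc s) zero    i       = ≡.refl
punchIn-comm {suc m} (suc s) (suc j) zero    = ≡.refl
punchIn-comm {suc m} (suc s) (suc j) (suc i) = ≡.cong suc (punchIn-comm s j i)

module DeterminantProperties {c ℓ} (A : CommutativeRing c ℓ) where
  open CommutativeRing A hiding (zero)
  open BigOperators commutativeSemiring
  open BigOperatorProperties commutativeSemiring
  open Cancellation commutativeSemiring
  open Determinant A
  open RawSemiringOps (CommutativeSemiring.rawSemiring commutativeSemiring) using (_^_)
  open RingProperties ring using (-‿distribˡ-*; -‿involutive)
  open SemiringSum semiring using (sum-remove; *-distribˡ-sum)
  open SemiringSolver commutativeSemiring using (solve; _:+_; _:*_; _:=_; con)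
  open SetoidReasoning setoid

  sgn : ∀ {m} → Fin m → Carrier
  sgn j = (- 1#) ^ toℕ j

  -1*-1≈1 : (- 1#) * (- 1#) ≈ 1#
  -1*-1≈1 = trans (sym (-‿distribˡ-* 1# (- 1#))) (trans (-‿cong (*-identityˡ _)) (-‿involutive 1#))

  sgn-square : ∀ {m} (j : Fin m) → sgn j * sgn j ≈ 1#
  sgn-square zero    = *-identityˡ 1#
  sgn-square (suc j) = trans
    (solve 2 (λ e x → (e :* x) :* (e :* x) := (e :* e) :* (x :* x)) refl (- 1#) (sgn j))
    (trans (*-cong -1*-1≈1 (sgn-square j)) (*-identityˡ 1#))

  -- Exchanging the order of the two deletions moves exactly one of the two indices by one, which
  -- changes the parity of their sum.
  sgn-shift : ∀ {m} (s : Fin (suc (suc m))) j →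
              sgn (punchIn s j) * sgn (shift s j) ≈ (- 1#) * (sgn s * sgn j)
  sgn-shift zero j =
    solve 2 (λ e x → (e :* x) :* con 1 := e :* (con 1 :* x)) refl (- 1#) (sgn j)
  sgn-shift (suc s) zero = begin
    1# * sgn s                           ≈⟨ *-congʳ -1*-1≈1 ⟨
    ((- 1#) * (- 1#)) * sgn s            ≈⟨ solve 2 (λ e x → (e :* e) :* x := e :* ((e :* x) :* con 1))
                                              refl (- 1#) (sgn s) ⟩
    (- 1#) * (((- 1#) * sgn s) * 1#)     ∎
  sgn-shift {suc m} (suc s) (suc j) = begin
    ((- 1#) * sgn (punchIn s j)) * ((- 1#) * sgn (shift s j))
      ≈⟨ solve 3 (λ e x y → (e :* x) :* (e :* y) := (e :* e) :* (x :* y)) refl (- 1#) _ _ ⟩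
    ((- 1#) * (- 1#)) * (sgn (punchIn s j) * sgn (shift s j))
      ≈⟨ *-congˡ (sgn-shift s j) ⟩
    ((- 1#) * (- 1#)) * ((- 1#) * (sgn s * sgn j))
      ≈⟨ solve 3 (λ e x y → (e :* e) :* (e :* (x :* y)) := e :* ((e :* x) :* (e :* y)))
           refl (- 1#) _ _ ⟩
    (- 1#) * (((- 1#) * sgn s) * ((- 1#) * sgn j)) ∎

  private
    Mat : ℕ → Set _
    Mat m = Fin m → Fin m → Carrier

    minor₀ : ∀ {m} → Mat (suc m) → Fin (suc m) → Mat m
    minor₀ a j r s = a (suc r) (punchIn j s)

    term : ∀ {m} → Mat (suc m) → Fin (suc m) → Carrier
    term a j = sgn j * (a zero j * det (minor₀ a j))

    term≈0 : ∀ {x y} z → y ≈ 0# → z * (x * y) ≈ 0#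
    term≈0 z y≈0 = trans (*-congˡ (trans (*-congˡ y≈0) (zeroʳ _))) (zeroʳ z)

    term≈0′ : ∀ {x y} z → x ≈ 0# → z * (x * y) ≈ 0#
    term≈0′ z x≈0 = trans (*-congˡ (trans (*-congʳ x≈0) (zeroˡ _))) (zeroʳ z)

  det-cong : ∀ {m} (a b : Mat m) → (∀ r s → a r s ≈ b r s) → det a ≈ det b
  det-cong {zero}  a b a≈b = refl
  det-cong {suc m} a b a≈b = ∑-cong (term a) (term b) λ j →
    *-congˡ (*-cong (a≈b zero j)
      (det-cong (minor₀ a j) (minor₀ b j) λ r s → a≈b (suc r) (punchIn j s)))

  det-scale-rows : ∀ {m} (t : Fin m → Carrier) (a : Mat m) →
                   det (λ r s → t r * a r s) ≈ ∏ t * det a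
  det-scale-rows {zero}  t a = sym (*-identityˡ 1#)
  det-scale-rows {suc m} t a = trans
    (∑-cong _ (λ j → (t zero * ∏ (t ∘ suc)) * (sgn j * (a zero j * minor j))) λ j → trans
      (*-congˡ (*-congˡ (det-scale-rows (t ∘ suc) λ r s → a (suc r) (punchIn j s))))
      (solve 5 (λ e x a y d → e :* ((x :* a) :* (y :* d)) := (x :* y) :* (e :* (a :* d)))
        refl (sgn j) (t zero) (a zero j) (∏ (t ∘ suc)) (minor j)))
    (sym (*-distribˡ-sum (t zero * ∏ (t ∘ suc)) (λ j → sgn j * (a zero j * minor j))))
    where
    minor : Fin (suc m) → Carrier
    minor j = det λ r s → a (suc r) (punchIn j s)

  det-zero-row : ∀ {m} (a : Mat m) r → (∀ s → a r s ≈ 0#) → det a ≈ 0#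
  det-zero-row a zero    a≈0 = ∑-zero (term a) λ j → term≈0′ (sgn j) (a≈0 j)
  det-zero-row a (suc r) a≈0 = ∑-zero (term a) λ j →
    term≈0 (sgn j) (det-zero-row (minor₀ a j) r λ s → a≈0 (punchIn j s))

  -- Expansion is along row zero, and a minor that omits a later column still has column zero as its
  -- first column.
  det-zero-column : ∀ {m} (a : Mat (suc m)) → (∀ r → a r zero ≈ 0#) → det a ≈ 0#
  det-zero-column {zero}  a a≈0 = ∑-zero (term a) λ { zero → term≈0′ 1# (a≈0 zero) }
  det-zero-column {suc m} a a≈0 = ∑-zero (term a) λ where
    zero    → term≈0′ 1# (a≈0 zero)
    (suc j) → term≈0 (sgn (suc j)) (det-zero-column (minor₀ a (suc j)) λ r → a≈0 (suc r))

  -- In the expansion only the first term survives, since every other minor contains the first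
  -- column below the diagonal entry, which is zero.
  det-upper-cancellable : ∀ {m} (a : Mat m) → (∀ r s → s Fin.< r → a r s ≈ 0#) →
                          (∀ r → Cancellable (a r r)) → Cancellable (det a)
  det-upper-cancellable {zero}  a upper a-c = 1-cancellable
  det-upper-cancellable {suc m} a upper a-c = cancellable-cong
    (sym (trans (+-cong (*-identityˡ _) (∑-zero (λ j → term a (suc j)) (off-diagonal a upper)))
      (+-identityʳ _)))
    (*-cancellable (a-c zero) (det-upper-cancellable (minor₀ a zero)
      (λ r s s<r → upper (suc r) (suc s) (s<s s<r)) (λ r → a-c (suc r))))
    where
    off-diagonal : ∀ {m} (a : Mat (suc m)) → (∀ r s → s Fin.< r → a r s ≈ 0#) → ∀ j →
      term a (suc j) ≈ 0#
    off-diagonal {suc m} a upper j =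
      term≈0 (sgn (suc j)) (det-zero-column (minor₀ a (suc j)) λ r → upper (suc r) zero z<s)

  -- Laplace expansion along row `r`, by induction on `r` because `det` expands along row zero only.
  -- For a later row, the minor without column `s` has a zero row, and in the other minors the unit
  -- row has moved up by one and its one sits at `shift s j`.
  det-unit-row : ∀ {m} (a : Mat (suc m)) r s → a r s ≈ 1# → (∀ j → a r (punchIn s j) ≈ 0#) →
    det a ≈ (sgn r * sgn s) * det (λ i j → a (punchIn r i) (punchIn s j))
  det-unit-row a zero s a≈1 a≈0 = begin
    det a
      ≈⟨ sum-remove {i = s} (term a) ⟩
    term a s + ∑ (λ j → term a (punchIn s j))
      ≈⟨ +-cong (*-congˡ (trans (*-congʳ a≈1) (*-identityˡ _)))
                (∑-zero (λ j → term a (punchIn s j)) λ j → term≈0′ (sgn (punchIn s j)) (a≈0 j)) ⟩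
    sgn s * minor s + 0#
      ≈⟨ +-identityʳ _ ⟩
    sgn s * minor s
      ≈⟨ *-congʳ (*-identityˡ (sgn s)) ⟨
    (1# * sgn s) * minor s ∎
    where
    minor : Fin (suc _) → Carrier
    minor j = det (minor₀ a j)
  det-unit-row {suc m} a (suc r) s a≈1 a≈0 = begin
    det a
      ≈⟨ sum-remove {i = s} (term a) ⟩
    term a s + ∑ (λ j → term a (punchIn s j))
      ≈⟨ +-cong (term≈0 (sgn s) (det-zero-row (minor₀ a s) r a≈0))
                (∑-cong (λ j → term a (punchIn s j))
                   (λ j → (sgn (suc r) * sgn s) * (sgn j * (a zero (punchIn s j) * minor₂ j)))
                   term-punchIn) ⟩
    0# + ∑ (λ j → (sgn (suc r) * sgn s) * (sgn j * (a zero (punchIn s j) * minor₂ j)))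
      ≈⟨ +-identityˡ _ ⟩
    ∑ (λ j → (sgn (suc r) * sgn s) * (sgn j * (a zero (punchIn s j) * minor₂ j)))
      ≈⟨ *-distribˡ-sum (sgn (suc r) * sgn s) (λ j → sgn j * (a zero (punchIn s j) * minor₂ j)) ⟨
    (sgn (suc r) * sgn s) * ∑ (λ j → sgn j * (a zero (punchIn s j) * minor₂ j)) ∎
    where
    minor : Fin (suc (suc m)) → Carrier
    minor j = det (minor₀ a j)

    minor₂ : Fin (suc m) → Carrier
    minor₂ j = det λ i c → a (suc (punchIn r i)) (punchIn s (punchIn j c))

    expand : ∀ j → minor (punchIn s j) ≈ (sgn r * sgn (shift s j)) * minor₂ j
    expand j = trans
      (det-unit-row (minor₀ a (punchIn s j)) r (shift s j)
        (trans (reflexive (≡.cong (a (suc r)) (punchIn-shift s j))) a≈1)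
        (λ c → trans (reflexive (≡.cong (a (suc r)) (punchIn-comm s j c))) (a≈0 (punchIn j c))))
      (*-congˡ (det-cong _ _ λ i c →
        reflexive (≡.cong (a (suc (punchIn r i))) (punchIn-comm s j c))))

    term-punchIn : ∀ j → sgn (punchIn s j) * (a zero (punchIn s j) * minor (punchIn s j)) ≈
                 (sgn (suc r) * sgn s) * (sgn j * (a zero (punchIn s j) * minor₂ j))
    term-punchIn j = begin
      sgn (punchIn s j) * (x * minor (punchIn s j))
        ≈⟨ *-congˡ (*-congˡ (expand j)) ⟩
      sgn (punchIn s j) * (x * ((sgn r * sgn (shift s j)) * minor₂ j))
        ≈⟨ solve 5 (λ p x r q d → p :* (x :* ((r :* q) :* d)) := (p :* q) :* (r :* (x :* d)))
             refl (sgn (punchIn s j)) x (sgn r) (sgn (shift s j)) (minor₂ j) ⟩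
      (sgn (punchIn s j) * sgn (shift s j)) * (sgn r * (x * minor₂ j))
        ≈⟨ *-congʳ (sgn-shift s j) ⟩
      ((- 1#) * (sgn s * sgn j)) * (sgn r * (x * minor₂ j))
        ≈⟨ solve 6 (λ e s j r x d →
               (e :* (s :* j)) :* (r :* (x :* d)) := ((e :* r) :* s) :* (j :* (x :* d)))
             refl (- 1#) (sgn s) (sgn j) (sgn r) x (minor₂ j) ⟩
      (sgn (suc r) * sgn s) * (sgn j * (x * minor₂ j)) ∎
      where x = a zero (punchIn s j)

-- Subsets: inserting an element, and the order as a ballot condition.

-- A single relation serves both for adding `k` to a column of C and for recovering a column of D
-- from the one with `k` removed.
data Insert : ∀ {n} → Fin n → Subset n → Subset n → Set where
  here  : ∀ {n} {S : Subset n} → Insert zero (outside ∷ S) (inside ∷ S)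
  there : ∀ {n k x} {S S⁺ : Subset n} → Insert k S S⁺ → Insert (suc k) (x ∷ S) (x ∷ S⁺)

insert : ∀ {n k} {S : Subset n} → k ∉ S → Σ (Subset n) (Insert k S)
insert {k = zero}  {inside ∷ S}  k∉S = contradiction here k∉S
insert {k = zero}  {outside ∷ S} k∉S = inside ∷ S , here
insert {k = suc k} {x ∷ S}       k∉S =
  let S⁺ , ins = insert (λ k∈S → k∉S (there k∈S)) in x ∷ S⁺ , there ins

insert-remove : ∀ {n k} {S : Subset n} → k ∈ S → Insert k (S - k) S
insert-remove {S = inside ∷ S} here =
  ≡.subst (λ T → Insert zero (outside ∷ T) (inside ∷ S)) (≡.sym (p─⊥≡p S)) here
insert-remove (there k∈S) = there (insert-remove k∈S)

remove-∉ : ∀ {n k} {S : Subset n} → k ∉ S → S - k ≡ S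
remove-∉ {k = zero}  {inside ∷ S}  k∉S = contradiction here k∉S
remove-∉ {k = zero}  {outside ∷ S} k∉S = ≡.cong (outside ∷_) (p─⊥≡p S)
remove-∉ {k = suc k} {x ∷ S}       k∉S = ≡.cong (x ∷_) (remove-∉ (λ k∈S → k∉S (there k∈S)))

element : ∀ {n} (S : Subset n) → Fin ∣ S ∣ → Fin n
element S = lookup (elements S)

element-inside : ∀ {n} (S : Subset n) a → element (inside ∷ S) (suc a) ≡ suc (element S a)
element-inside S a = lookup-map a suc (elements S)

element-outside : ∀ {n} (S : Subset n) a → element (outside ∷ S) a ≡ suc (element S a)
element-outside S a = lookup-map a suc (elements S)

-- The passage from sets to matrix indices: `position` is the rank of `k`, hence the row or column
-- that `det-unit-row` deletes.
record Position {n} (k : Fin n) (S S⁺ : Subset n) : Set where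
  field
    card     : suc ∣ S ∣ ≡ ∣ S⁺ ∣
    position : Fin (suc ∣ S ∣)
    at       : element S⁺ (cast card position) ≡ k
    others   : ∀ a → element S⁺ (cast card (punchIn position a)) ≡ element S a

insert-position : ∀ {n k} {S S⁺ : Subset n} → Insert k S S⁺ → Position k S S⁺
insert-position {S = _ ∷ S} here = record
  { card = ≡.refl ; position = zero ; at = ≡.refl
  ; others = λ a → ≡.trans (element-inside S _) (≡.trans
      (≡.cong (suc ∘ element S) (Fin.cast-is-id ≡.refl a)) (≡.sym (element-outside S a))) }
insert-position {S = inside ∷ S} {inside ∷ S⁺} (there ins) = record
  { card = ≡.cong suc card ; position = suc position
  ; at = ≡.trans (element-inside S⁺ _) (≡.cong suc at)
  ; others = λ { zero → ≡.refl ; (suc a) → ≡.trans (element-inside S⁺ _)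
      (≡.trans (≡.cong suc (others a)) (≡.sym (element-inside S a))) } }
  where open Position (insert-position ins)
insert-position {S = outside ∷ S} {outside ∷ S⁺} (there ins) = record
  { card = card ; position = position
  ; at = ≡.trans (element-outside S⁺ _) (≡.cong suc at)
  ; others = λ a → ≡.trans (element-outside S⁺ _)
      (≡.trans (≡.cong suc (others a)) (≡.sym (element-outside S a))) }
  where open Position (insert-position ins)

-- Ballot d R S: reading both sets from left to right, R is never behind S,
-- when R starts with a lead of d elements and ends with none.
data Ballot : ∀ {n} → ℕ → Subset n → Subset n → Set where
  done  : Ballot 0 [] []
  both  : ∀ {n d x} {R S : Subset n} → Ballot d R S → Ballot d (x ∷ R) (x ∷ S)
  left  : ∀ {n d} {R S : Subset n} → Ballot (suc d) R S → Ballot d (inside ∷ R) (outside ∷ S)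
  right : ∀ {n d} {R S : Subset n} → Ballot d R S → Ballot (suc d) (outside ∷ R) (inside ∷ S)

-- A common new element turns a `both` step where it is absent into one where it is present and
-- leaves every lead unchanged. In terms of ranks, the two sets would be shifted from different
-- places on.
ballot-insert : ∀ {n d k} {R R⁺ S S⁺ : Subset n} → Ballot d R S →
                Insert k R R⁺ → Insert k S S⁺ → Ballot d R⁺ S⁺
ballot-insert (both p)  here      here       = both p
ballot-insert (both p)  (there r) (there s)  = both (ballot-insert p r s)
ballot-insert (left p)  (there r) (there s)  = left (ballot-insert p r s)
ballot-insert (right p) (there r) (there s)  = right (ballot-insert p r s)

private
  -- `_≤ˢ_` for what remains to be read: with a lead of `d`, the next element of `R` is matched with
  -- an element of `S` that is `d` places further on. Relating `a` and `b` through `toℕ` avoids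
  -- casts in the induction.
  Shifted : ∀ {n} → ℕ → Subset n → Subset n → Set
  Shifted d R S = ∣ R ∣ ℕ+ d ≡ ∣ S ∣ ×
    (∀ a b → toℕ b ≡ d ℕ+ toℕ a → element R a Fin.≤ element S b)

  suc-≤ : ∀ {n} {i j : Fin n} {i′ j′ : Fin (suc n)} → i′ ≡ suc i → j′ ≡ suc j →
          i Fin.≤ j → i′ Fin.≤ j′
  suc-≤ ≡.refl ≡.refl = s≤s

  ≤-suc : ∀ {n} {i j : Fin n} {i′ j′ : Fin (suc n)} → i′ ≡ suc i → j′ ≡ suc j →
          i′ Fin.≤ j′ → i Fin.≤ j
  ≤-suc ≡.refl ≡.refl = s≤s⁻¹

  ballot⇒shifted : ∀ {n d} {R S : Subset n} → Ballot d R S → Shifted d R S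
  ballot⇒shifted done = ≡.refl , λ ()
  ballot⇒shifted {d = d} {inside ∷ R} {S = _ ∷ S} (both p) with ballot⇒shifted p
  ... | card , ≤ = ≡.cong suc card , λ where
    zero    b       eq → z≤n
    (suc a) zero    eq → contradiction (≡.trans eq (ℕ.+-suc d (toℕ a))) λ ()
    (suc a) (suc b) eq → suc-≤ (element-inside R a) (element-inside S b)
      (≤ a b (ℕ.suc-injective (≡.trans eq (ℕ.+-suc d (toℕ a)))))
  ballot⇒shifted {R = outside ∷ R} {S = _ ∷ S} (both p) with ballot⇒shifted p
  ... | card , ≤ = card , λ a b eq → suc-≤ (element-outside R a) (element-outside S b) (≤ a b eq)
  ballot⇒shifted {d = d} {_ ∷ R} {_ ∷ S} (left p) with ballot⇒shifted p
  ... | card , ≤ = ≡.trans (≡.sym (ℕ.+-suc ∣ R ∣ d)) card , λ where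
    zero    b eq → z≤n
    (suc a) b eq → suc-≤ (element-inside R a) (element-outside S b)
      (≤ a b (≡.trans eq (ℕ.+-suc d (toℕ a))))
  ballot⇒shifted {d = suc d} {_ ∷ R} {_ ∷ S} (right p) with ballot⇒shifted p
  ... | card , ≤ = ≡.trans (ℕ.+-suc ∣ R ∣ d) (≡.cong suc card) , λ where
    a (suc b) eq → suc-≤ (element-outside R a) (element-inside S b) (≤ a b (ℕ.suc-injective eq))

  shifted⇒ballot : ∀ {n} d (R S : Subset n) → Shifted d R S → Ballot d R S
  shifted⇒ballot zero [] [] _ = done
  shifted⇒ballot (suc d) [] [] (() , _)
  shifted⇒ballot d (inside ∷ R) (inside ∷ S) (card , ≤) =
    both (shifted⇒ballot d R S (ℕ.suc-injective card , λ a b eq →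
      ≤-suc (element-inside R a) (element-inside S b)
        (≤ (suc a) (suc b) (≡.trans (≡.cong suc eq) (≡.sym (ℕ.+-suc d (toℕ a)))))))
  shifted⇒ballot d (outside ∷ R) (outside ∷ S) (card , ≤) =
    both (shifted⇒ballot d R S (card , λ a b eq →
      ≤-suc (element-outside R a) (element-outside S b) (≤ a b eq)))
  shifted⇒ballot d (inside ∷ R) (outside ∷ S) (card , ≤) =
    left (shifted⇒ballot (suc d) R S (≡.trans (ℕ.+-suc ∣ R ∣ d) card , λ a b eq →
      ≤-suc (element-inside R a) (element-outside S b)
        (≤ (suc a) b (≡.trans eq (≡.sym (ℕ.+-suc d (toℕ a)))))))
  shifted⇒ballot (suc d) (outside ∷ R) (inside ∷ S) (card , ≤) =
    right (shifted⇒ballot d R S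
      (ℕ.suc-injective (≡.trans (≡.sym (ℕ.+-suc ∣ R ∣ d)) card) , λ a b eq →
        ≤-suc (element-outside R a) (element-inside S b) (≤ a (suc b) (≡.cong suc eq))))
  -- Impossible: `S` has an element at zero, while the first element of `R`, which exists because
  -- the sizes agree, comes later.
  shifted⇒ballot {suc n} zero (outside ∷ R) (inside ∷ S) (card , ≤) = contradiction
    (≡.subst (Fin._≤ zero {n}) (element-outside R a) (≤ a zero (≡.sym (Fin.toℕ-cast eq zero)))) λ ()
    where
    eq : suc ∣ S ∣ ≡ ∣ R ∣
    eq = ≡.sym (≡.trans (≡.sym (ℕ.+-identityʳ _)) card)
    a = cast eq zero

≤ˢ⇒ballot : ∀ {n} {R S : Subset n} → R ≤ˢ S → Ballot 0 R S
≤ˢ⇒ballot {R = R} {S} R≤S = shifted⇒ballot 0 R S (≡.trans (ℕ.+-identityʳ _) card ,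
  λ a b eq → ≡.subst (λ b → element R a Fin.≤ element S b)
    (Fin.toℕ-injective (≡.trans (Fin.toℕ-cast card a) (≡.sym eq))) (pointwise a))
  where open _≤ˢ_ R≤S

ballot⇒≤ˢ : ∀ {n} {R S : Subset n} → Ballot 0 R S → R ≤ˢ S
ballot⇒≤ˢ p with ballot⇒shifted p
... | card , ≤ = record
  { card = ≡.trans (≡.sym (ℕ.+-identityʳ _)) card
  ; pointwise = λ a → ≤ a _ (Fin.toℕ-cast (≡.trans (≡.sym (ℕ.+-identityʳ _)) card) a) }

≤ˢ-refl : ∀ {n} (S : Subset n) → S ≤ˢ S
≤ˢ-refl S = ballot⇒≤ˢ (go S)
  where
  go : ∀ {n} (S : Subset n) → Ballot 0 S S
  go []      = done
  go (x ∷ S) = both (go S)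

≤ˢ-insert : ∀ {n k} {R R⁺ S S⁺ : Subset n} → R ≤ˢ S →
            Insert k R R⁺ → Insert k S S⁺ → R⁺ ≤ˢ S⁺
≤ˢ-insert R≤S r s = ballot⇒≤ˢ (ballot-insert (≤ˢ⇒ballot R≤S) r s)

infix 4 _≤ˢ?_
_≤ˢ?_ : ∀ {n} (R S : Subset n) → Dec (R ≤ˢ S)
R ≤ˢ? S with ∣ R ∣ ℕ.≟ ∣ S ∣
... | no ∣R∣≢∣S∣ = no λ R≤S → ∣R∣≢∣S∣ (_≤ˢ_.card R≤S)
... | yes eq = map′ (λ ≤ → record { card = eq ; pointwise = ≤ }) _≤ˢ_.pointwise
  (Fin.all? λ a → element R a Fin.≤? element S (cast eq a))

-- Monomials of subsets, and enumeration of the diagrams below a given one.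

module SubsetProduct {c ℓ} (A : CommutativeSemiring c ℓ) where
  open CommutativeSemiring A hiding (zero)
  open BigOperators A
  open BigOperatorProperties A
  open CommutativeSemigroupProperties *-commutativeSemigroup using (x∙yz≈y∙xz)

  -- Written with indicators as in `removedMonomial`, whose second factor is thereby literally
  -- `∏∈ X (D l) var`; `∏-elements` connects it with the rows of a minor.
  ∏∈ : ∀ {n} → Subset n → (Fin n → Carrier) → Carrier
  ∏∈ S x = ∏ λ i → if does (i ∈? S) then x i else 1#

  ∏-elements : ∀ {n} (S : Subset n) x → ∏ (λ a → x (element S a)) ≈ ∏∈ S x
  ∏-elements []            x = refl
  ∏-elements (inside ∷ S)  x = *-congˡ (trans
    (∏-cong _ _ λ a → reflexive (≡.cong x (element-inside S a))) (∏-elements S (x ∘ suc)))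
  ∏-elements (outside ∷ S) x = trans
    (trans (∏-cong _ _ λ a → reflexive (≡.cong x (element-outside S a))) (∏-elements S (x ∘ suc)))
    (sym (*-identityˡ _))

  ∏∈-insert : ∀ {n k} {S S⁺ : Subset n} x → Insert k S S⁺ → ∏∈ S⁺ x ≈ x k * ∏∈ S x
  ∏∈-insert x here        = *-congˡ (sym (*-identityˡ _))
  ∏∈-insert {S = inside ∷ S} x (there ins) =
    trans (*-congˡ (∏∈-insert (x ∘ suc) ins)) (x∙yz≈y∙xz _ _ _)
  ∏∈-insert {S = outside ∷ S} x (there ins) =
    trans (*-congˡ (∏∈-insert (x ∘ suc) ins)) (x∙yz≈y∙xz _ _ _)

choices : ∀ {b m} {B : Fin m → Set b} → (∀ j → List (B j)) → List (∀ j → B j)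
choices {m = zero}  xs = (λ ()) ∷ []
choices {m = suc m} xs =
  List.concatMap (λ x → List.map (Fin.∀-cons x) (choices (λ j → xs (suc j)))) (xs zero)

-- Functions are found only up to a pointwise predicate; an equation between functions would require
-- extensionality.
choices-complete : ∀ {b q m} {B : Fin m → Set b} (xs : ∀ j → List (B j)) {Q : ∀ j → B j → Set q} →
  (∀ j → Any (Q j) (xs j)) → Any (λ f → ∀ j → Q j (f j)) (choices xs)
choices-complete {m = zero}  xs any = here λ ()
choices-complete {m = suc m} xs any = Any.concatMap⁺ _
  (Any.map (λ Qx → Any.map⁺ (Any.map (λ Qf → Fin.∀-cons Qx Qf)
    (choices-complete (λ j → xs (suc j)) (λ j → any (suc j))))) (any zero))

subsets : ∀ n → List (Subset n)
subsets zero    = [] ∷ []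
subsets (suc n) = List.map (inside ∷_) (subsets n) ++ List.map (outside ∷_) (subsets n)

subsets-complete : ∀ {n} (S : Subset n) → S ∈ᴸ subsets n
subsets-complete []            = here ≡.refl
subsets-complete (inside ∷ S)  = ∈-++⁺ˡ (∈-map⁺ _ (subsets-complete S))
subsets-complete {suc n} (outside ∷ S) =
  ∈-++⁺ʳ (List.map (inside ∷_) (subsets n)) (∈-map⁺ _ (subsets-complete S))

subsets≤ : ∀ {n} (S : Subset n) → List (Subset n) → List (Σ (Subset n) (_≤ˢ S))
subsets≤ S []       = []
subsets≤ S (R ∷ Rs) with R ≤ˢ? S
... | yes R≤S = (R , R≤S) ∷ subsets≤ S Rs
... | no _    = subsets≤ S Rs

subsets≤-complete : ∀ {n} {R S : Subset n} → R ≤ˢ S → ∀ {Rs} → R ∈ᴸ Rs →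
                    Any (λ R′ → proj₁ R′ ≡ R) (subsets≤ S Rs)
subsets≤-complete {S = S} R≤S {R ∷ Rs} R∈ with R ≤ˢ? S | R∈
... | yes _  | here eq  = here (≡.sym eq)
... | yes _  | there R∈ = there (subsets≤-complete R≤S R∈)
... | no R≰S | here ≡.refl = contradiction R≤S R≰S
... | no _   | there R∈ = subsets≤-complete R≤S R∈

diagrams≤ : ∀ {n} (D : Diagram n) → List (Σ (Diagram n) (_≤ᴰ D))
diagrams≤ {n} D =
  List.map (λ f → proj₁ ∘ f , λ j → proj₂ (f j)) (choices λ j → subsets≤ (D j) (subsets n))

diagrams≤-complete : ∀ {n} {C D : Diagram n} → C ≤ᴰ D →
                     Any (λ C′ → ∀ j → proj₁ C′ j ≡ C j) (diagrams≤ D)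
diagrams≤-complete C≤D = Any.map⁺ (choices-complete _ λ j →
  subsets≤-complete (C≤D j) (subsets-complete _))

element-∈ : ∀ {n} (S : Subset n) a → element S a ∈ S
element-∈ (inside ∷ S)  zero    = here
element-∈ (inside ∷ S)  (suc a) rewrite element-inside S a  = there (element-∈ S a)
element-∈ (outside ∷ S) a       rewrite element-outside S a = there (element-∈ S a)

element-mono-< : ∀ {n} (S : Subset n) {a b} → a Fin.< b → element S a Fin.< element S b
element-mono-< (inside ∷ S) {zero}  {suc b} a<b rewrite element-inside S b = z<s
element-mono-< (inside ∷ S) {suc a} {suc b} (s<s a<b)
  rewrite element-inside S a | element-inside S b = s<s (element-mono-< S a<b)
element-mono-< (outside ∷ S) {a} {b} a<b
  rewrite element-outside S a | element-outside S b = s<s (element-mono-< S a<b)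

insert-∉ : ∀ {n k} {S S⁺ : Subset n} → Insert k S S⁺ → k ∉ S
insert-∉ (there ins) (there k∈S) = insert-∉ ins k∈S

-- Monomials of diagrams and their evaluation.

module Weight {c ℓ} (A : CommutativeSemiring c ℓ) where
  open CommutativeSemiring A
  open BigOperators A
  open SubsetProduct A

  weight : ∀ {n} → (Fin n → Carrier) → Diagram n → Carrier
  weight x C = ∏ λ j → ∏∈ (C j) x

module WeightEvaluation {c ℓ s ℓ′} (A : CommutativeSemiring c ℓ) (S : CommutativeSemiring s ℓ′)
                        {n : ℕ} where
  private
    module A = CommutativeSemiring A
    module S = CommutativeSemiring S
    P = PolynomialSemiring.polySemiring A (Fin n)
  open BigOperatorProperties S
  open SubsetProduct
  open Weight

  module _ {h : A.Carrier → S.Carrier} (h1 : h A.1# S.≈ S.1#) (ρ : Fin n → S.Carrier) where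

    eval-weight : ∀ C → eval S h ρ (weight P var C) S.≈ weight S ρ C
    eval-weight C = S.trans (Evaluation.eval-∏ A S ρ h1 λ j → ∏∈ P (C j) var)
      (∏-cong _ _ λ j → S.trans
        (Evaluation.eval-∏ A S ρ h1 λ i → if does (i ∈? C j) then var i else con A.1#)
        (∏-cong _ _ λ i → factor (does (i ∈? C j)) i))
      where
      factor : ∀ b i → eval S h ρ (if b then var i else con A.1#) S.≈ (if b then ρ i else S.1#)
      factor true  i = S.refl
      factor false i = h1

    eval-weights : h A.0# S.≈ S.0# → ∀ {m} (C : Fin m → Diagram n) →
      eval S h ρ (BigOperators.∑ P λ a → weight P var (C a)) S.≈
      BigOperators.∑ S λ a → weight S ρ (C a)
    eval-weights h0 C = S.trans (Evaluation.eval-∑ A S ρ h0 λ a → weight P var (C a))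
      (∑-cong _ _ λ a → eval-weight (C a))

module PolynomialDeterminant {c ℓ v} (R : CommutativeRing c ℓ) (V : Set v) where
  private module R = CommutativeRing R
  open PolynomialRing R V
  open Determinant polyRing
  open BigOperatorProperties polySemiring
  open RawSemiringOps (CommutativeSemiring.rawSemiring polySemiring) using (_^_)

  eval-^ : ∀ ρ d → eval polySemiring con ρ ((⊖ con R.1#) ^ d) ≃ (⊖ con R.1#) ^ d
  eval-^ ρ zero    = ≃-refl
  eval-^ ρ (suc d) = ⊗-cong ≃-refl (eval-^ ρ d)

  eval-det : ∀ ρ {m} (a : Fin m → Fin m → Poly R.Carrier V) →
             eval polySemiring con ρ (det a) ≃ det λ r s → eval polySemiring con ρ (a r s)
  eval-det ρ {zero}  a = ≃-refl
  eval-det ρ {suc m} a = ≃-trans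
    (Evaluation.eval-∑ R.commutativeSemiring polySemiring {h = con} ρ ≃-refl
      λ j → (⊖ con R.1#) ^ toℕ j ⊗ (a zero j ⊗ det (λ r s → a (suc r) (punchIn j s))))
    (∑-cong _ (λ j → (⊖ con R.1#) ^ toℕ j ⊗ (eval polySemiring con ρ (a zero j) ⊗
        det (λ r s → eval polySemiring con ρ (a (suc r) (punchIn j s)))))
      λ j → ⊗-cong (eval-^ ρ (toℕ j))
        (⊗-cong ≃-refl (eval-det ρ λ r s → a (suc r) (punchIn j s))))

-- The torus action on generators, and the dual character.

module FlaggedWeylProperties {c ℓ₁ ℓ₂} (K : HeytingField c ℓ₁ ℓ₂) (n : ℕ) where
  private
    X = ℤ[x]-semiring n
    R = commutativeRing K
    module K = CommutativeRing R
  open FlaggedWeyl K n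
    using (Index; y; K[Y]; Y; minor; generator; ℳ; Torus; act; diag; diagonal; diagonal-≡;
           diagonal-≢; IsBasis; _⁻¹)
  open PolynomialRing R Index
  open BigOperators polySemiring
  open BigOperatorProperties polySemiring
  open Determinant polyRing
  open PolynomialDeterminant R Index
  module Det = DeterminantProperties polyRing
  open SetoidReasoning (CommutativeSemiring.setoid polySemiring)

  _≟ᴵ_ : DecidableEquality Index
  y i j _ ≟ᴵ y i′ j′ _ with i Fin.≟ i′ | j Fin.≟ j′
  ... | yes ≡.refl | yes ≡.refl = yes ≡.refl
  ... | yes _      | no j≢j′    = no λ { ≡.refl → j≢j′ ≡.refl }
  ... | no i≢i′    | _          = no λ { ≡.refl → i≢i′ ≡.refl }

  private
    variableAt : ∀ i j → List Index
    variableAt i j with i Fin.≤? j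
    ... | yes i≤j = y i j i≤j ∷ []
    ... | no _    = []

  variables : List Index
  variables = List.concatMap (λ i → List.concatMap (variableAt i) (List.allFin n)) (List.allFin n)

  variables-complete : ∀ x → x ∈ᴸ variables
  variables-complete x@(y i j i≤j) = Any.concatMap⁺ _
    (lose (∈-allFin i) (Any.concatMap⁺ _ (lose (∈-allFin j) at)))
    where
    at : x ∈ᴸ variableAt i j
    at with i Fin.≤? j
    ... | yes _   = here ≡.refl
    ... | no i≰j  = ⊥-elim-irr (i≰j i≤j)

  Y-≤ : ∀ {i j} .(i≤j : i Fin.≤ j) → Y i j ≡ var (y i j i≤j)
  Y-≤ {i} {j} i≤j with i Fin.≤? j
  ... | yes _   = ≡.refl
  ... | no i≰j  = ⊥-elim-irr (i≰j i≤j)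

  Y-≰ : ∀ {i j} → ¬ (i Fin.≤ j) → Y i j ≡ con K.0#
  Y-≰ {i} {j} i≰j with i Fin.≤? j
  ... | yes i≤j = contradiction i≤j i≰j
  ... | no _    = ≡.refl

  con-∏ : ∀ {m} (f : Fin m → K.Carrier) →
          ∏ (λ a → con (f a)) ≃ con (BigOperators.∏ K.commutativeSemiring f)
  con-∏ {zero}  f = ≃-refl
  con-∏ {suc m} f = ≃-trans (⊗-cong ≃-refl (con-∏ (f ∘ suc))) (≃-sym (con-* _ _))

  open SubsetProduct
  open Weight

  module _ (t : Torus) where
    open Torus t using (entry)

    -- The inversion in the dual character and the one in the action cancel, so that row `i` is
    -- scaled by `entry i` itself.
    act-Y : ∀ i j → act (diag (t ⁻¹)) (Y i j) ≃ con (entry i) ⊗ Y i j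
    act-Y i j = go (i Fin.≤? j)
      where
      go : Dec (i Fin.≤ j) → act (diag (t ⁻¹)) (Y i j) ≃ con (entry i) ⊗ Y i j
      go (no i≰j) = begin
        act (diag (t ⁻¹)) (Y i j)   ≡⟨ ≡.cong (act (diag (t ⁻¹))) (Y-≰ i≰j) ⟩
        con K.0#                    ≈⟨ ⊗-zeroʳ _ ⟨
        con (entry i) ⊗ con K.0#    ≡⟨ ≡.cong (con (entry i) ⊗_) (Y-≰ i≰j) ⟨
        con (entry i) ⊗ Y i j       ∎
      go (yes i≤j) = begin
        act (diag (t ⁻¹)) (Y i j)
          ≡⟨ ≡.cong (act (diag (t ⁻¹))) (Y-≤ i≤j) ⟩
        ∑ (λ r → con (diagonal entry i r) ⊗ Y r j)
          ≈⟨ ∑-single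
               (λ r → con (diagonal entry i r) ⊗ Y r j) i
               (λ r r≢i → ≃-trans
                 (⊗-cong (con-cong (diagonal-≢ entry i r (r≢i ∘ ≡.sym))) ≃-refl) (⊗-zeroˡ _)) ⟩
        con (diagonal entry i i) ⊗ Y i j
          ≈⟨ ⊗-cong (con-cong (diagonal-≡ entry i)) ≃-refl ⟩
        con (entry i) ⊗ Y i j ∎

    act-minor : ∀ R S e → act (diag (t ⁻¹)) (minor R S e) ≃
                          con (∏∈ K.commutativeSemiring R entry) ⊗ minor R S e
    act-minor R S e = begin
      act (diag (t ⁻¹)) (minor R S e)
        ≈⟨ eval-det _ (λ a b → Y (element R a) (element S (cast e b))) ⟩
      det (λ a b → act (diag (t ⁻¹)) (Y (element R a) (element S (cast e b))))
        ≈⟨ Det.det-cong _ _ (λ a b → act-Y (element R a) (element S (cast e b))) ⟩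
      det (λ a b → con (entry (element R a)) ⊗ Y (element R a) (element S (cast e b)))
        ≈⟨ Det.det-scale-rows (λ a → con (entry (element R a))) _ ⟩
      ∏ (λ a → con (entry (element R a))) ⊗ minor R S e
        ≈⟨ ⊗-cong (≃-trans (con-∏ (λ a → entry (element R a)))
             (con-cong (∏-elements K.commutativeSemiring R entry))) ≃-refl ⟩
      con (∏∈ K.commutativeSemiring R entry) ⊗ minor R S e ∎

    act-generator : ∀ D x → act (diag (t ⁻¹)) (generator D x) ≃
                            con (weight K.commutativeSemiring entry (proj₁ x)) ⊗ generator D x
    act-generator D (C , C≤D) = begin
      act (diag (t ⁻¹)) (∏ minors)
        ≈⟨ Evaluation.eval-∏ K.commutativeSemiring polySemiring {h = con} _ ≃-refl minors ⟩
      ∏ (λ j → act (diag (t ⁻¹)) (minors j))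
        ≈⟨ ∏-cong _ _ (λ j → act-minor (C j) (D j) (_≤ˢ_.card (C≤D j))) ⟩
      ∏ (λ j → con (∏∈ K.commutativeSemiring (C j) entry) ⊗ minors j)
        ≈⟨ ∏-distrib-* (λ j → con (∏∈ K.commutativeSemiring (C j) entry)) minors ⟩
      ∏ (λ j → con (∏∈ K.commutativeSemiring (C j) entry)) ⊗ ∏ minors
        ≈⟨ ⊗-cong (con-∏ (λ j → ∏∈ K.commutativeSemiring (C j) entry)) ≃-refl ⟩
      con (weight K.commutativeSemiring entry C) ⊗ ∏ minors ∎
      where
      minors : Fin n → K[Y]
      minors j = minor (C j) (D j) (_≤ˢ_.card (C≤D j))

  weights : ∀ {m} {D : Diagram n} → (Fin m → Σ (Diagram n) (_≤ᴰ D)) → Poly ℤ (Fin n)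
  weights js = BigOperators.∑ X λ a → weight X var (proj₁ (js a))

  isχ : ∀ {m} D (js : Fin m → Σ (Diagram n) (_≤ᴰ D)) → IsBasis (ℳ D) (generator D ∘ js) →
        Isχ K D (weights js)
  isχ {m} D js isBasis t = record
    { basis = generator D ∘ js
    ; isBasis = isBasis
    ; matrix = matrix
    ; action = λ b → ≃-trans (act-generator t D (js b)) (≃-sym (≃-trans
        (∑-single
          (λ a → con (matrix a b) ⊗ generator D (js a)) b
          (λ a a≢b → ≃-trans (⊗-cong (con-cong (off-diagonal a≢b)) ≃-refl) (⊗-zeroˡ _)))
        (⊗-cong (con-cong (on-diagonal b)) ≃-refl)))
    ; trace = K.trans
        (WeightEvaluation.eval-weights ℤ.+-*-commutativeSemiring K.commutativeSemiring
          -- `fromℤ (+ 1)` unfolds to `1# + 0#`, and `fromℤ (+ 0)` to `0#`.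
          (K.+-identityʳ K.1#) (Torus.entry t) K.refl (proj₁ ∘ js))
        (BigOperatorProperties.∑-cong K.commutativeSemiring _ _ λ a → K.sym (on-diagonal a)) }
    where
    eigenvalue : Fin m → K.Carrier
    eigenvalue a = weight K.commutativeSemiring (Torus.entry t) (proj₁ (js a))

    matrix : Fin m → Fin m → K.Carrier
    matrix a b = if does (a Fin.≟ b) then eigenvalue b else K.0#

    on-diagonal : ∀ a → matrix a a K.≈ eigenvalue a
    on-diagonal a rewrite dec-true (a Fin.≟ a) ≡.refl = K.refl

    off-diagonal : ∀ {a b} → a ≢ b → matrix a b K.≈ K.0#
    off-diagonal {a} {b} a≢b rewrite dec-false (a Fin.≟ b) a≢b = K.refl

-- Bases of flagged Weyl modules formed by generators.

module Bases {c ℓ₁ ℓ₂} (K : HeytingField c ℓ₁ ℓ₂) (char0 : CharacteristicZero K) (n : ℕ) where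
  private
    R = commutativeRing K
    module K = CommutativeRing R
  open FlaggedWeyl K n using (Index; K[Y]; Y; minor; generator; ℳ; IsBasis)
  open FlaggedWeylProperties K n
  open PolynomialRing R Index
  open BigOperators polySemiring
  open BigOperatorProperties polySemiring
  open RawSemiringOps (CommutativeSemiring.rawSemiring polySemiring) using (_^_)
  open Determinant polyRing
  open Combinations R Index public
  open DiscreteSubfield (primeField K char0)
  open Elimination R (primeField K char0) _≟ᴵ_ variables variables-complete public

  1≉0 : ¬ (K.1# K.≈ K.0#)
  1≉0 1≈0 = HeytingField.#-irrefl K (K.trans (K.+-identityʳ K.1#) 1≈0) (char0 0)

  ∑-over : ∀ {m} (f : Fin m → K[Y]) → (∀ a → Over (f a)) → Over (∑ f)
  ∑-over {zero}  f f∈ = 0-closed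
  ∑-over {suc m} f f∈ = f∈ zero , ∑-over (f ∘ suc) (f∈ ∘ suc)

  ∏-over : ∀ {m} (f : Fin m → K[Y]) → (∀ a → Over (f a)) → Over (∏ f)
  ∏-over {zero}  f f∈ = 1-closed
  ∏-over {suc m} f f∈ = f∈ zero , ∏-over (f ∘ suc) (f∈ ∘ suc)

  ^-over : ∀ d → Over ((⊖ con K.1#) ^ d)
  ^-over zero    = 1-closed
  ^-over (suc d) = (-‿closed 1-closed , 1-closed) , ^-over d

  det-over : ∀ {m} (a : Fin m → Fin m → K[Y]) → (∀ r s → Over (a r s)) → Over (det a)
  det-over {zero}  a a∈ = 1-closed
  det-over {suc m} a a∈ = ∑-over
    (λ j → (⊖ con K.1#) ^ toℕ j ⊗ (a zero j ⊗ det (λ r s → a (suc r) (punchIn j s))))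
    λ j → ^-over (toℕ j) ,
      (a∈ zero j , det-over (λ r s → a (suc r) (punchIn j s)) λ r s → a∈ (suc r) (punchIn j s))

  Y-over : ∀ i j → Over (Y i j)
  Y-over i j with i Fin.≤? j
  ... | yes _ = tt
  ... | no _  = 0-closed

  generator-over : ∀ D x → Over (generator D x)
  generator-over D (C , C≤D) = ∏-over (λ j → minor (C j) (D j) (_≤ˢ_.card (C≤D j))) λ j →
    det-over (λ a b → Y (element (C j) a) (element (D j) (cast (_≤ˢ_.card (C≤D j)) b))) λ a b →
      Y-over (element (C j) a) (element (D j) (cast (_≤ˢ_.card (C≤D j)) b))

  generator-cong : ∀ D x x′ → (∀ j → proj₁ x j ≡ proj₁ x′ j) → generator D x ≃ generator D x′
  generator-cong D (C , C≤D) (C′ , C′≤D) C≡C′ = ∏-cong _ _ λ j →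
    CommutativeSemiring.reflexive polySemiring
      (minor-cong (D j) (C≡C′ j) (_≤ˢ_.card (C≤D j)) (_≤ˢ_.card (C′≤D j)))
    where
    minor-cong : ∀ {R R′} S → R ≡ R′ → (e : ∣ R ∣ ≡ ∣ S ∣) (e′ : ∣ R′ ∣ ≡ ∣ S ∣) →
                 minor R S e ≡ minor R′ S e′
    -- `cast` takes its equation irrelevantly, so the two cardinality proofs give the same minor.
    minor-cong S ≡.refl e e′ = ≡.refl

  -- `ℳ D` is spanned by all pairs of a diagram and a proof, whereas `spans` speaks of a finite list
  -- that meets each diagram only up to pointwise equality; `generator-cong` bridges the gap.
  isBasis : ∀ D {m} (js : Fin m → Σ (Diagram n) (_≤ᴰ D)) → Complemented (generator D ∘ js) →
            (∀ {x} → x ∈ᴸ diagrams≤ D → InSpan (generator D ∘ js) (generator D x)) →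
            IsBasis (ℳ D) (generator D ∘ js)
  isBasis D js C spans = record
    { member = λ a → 1 , (λ _ → K.1#) , (λ _ → js a) , ≃-sym (≃-trans (⊕-idʳ _) (⊗-idˡ _))
    ; independent = Complemented.independent C
    ; spanning = λ { f (m , λs , is , eq) → InSpan-cong {b = generator D ∘ js} eq
        (InSpan-comb {b = generator D ∘ js} λs (generator D ∘ is) λ a → inSpan (is a)) } }
    where
    inSpan : ∀ x → InSpan (generator D ∘ js) (generator D x)
    inSpan x with find (diagrams≤-complete (proj₂ x))
    ... | x′ , x′∈ , eq = InSpan-cong {b = generator D ∘ js}
      (generator-cong D x x′ λ j → ≡.sym (eq j)) (spans x′∈)

-- Lifting a single column, and its image under `φ`.

module Lifting {c ℓ₁ ℓ₂} (K : HeytingField c ℓ₁ ℓ₂) {n : ℕ} (k l : Fin n) (D : Diagram n) where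
  private
    X = ℤ[x]-semiring n
    R = commutativeRing K
    module K = CommutativeRing R
  open FlaggedWeyl K n using (Index; y; K[Y]; Y; minor; generator)
  open FlaggedWeylProperties K n
  open PolynomialRing R Index
  open BigOperators polySemiring
  open Determinant polyRing
  open PolynomialDeterminant R Index
  open Cancellation polySemiring
  open SetoidReasoning (CommutativeSemiring.setoid polySemiring)
  open SubsetProduct
  private
    module Detᴷ = DeterminantProperties R
    module ℤX = CommutativeRing (ℤ[x]-ring n)

  -- Row k of Y becomes the k-th unit vector, so a minor through (k , k) is up to
  -- sign the minor without row and column k.
  φ : K[Y] → K[Y]
  φ = eval polySemiring con λ (y i j i≤j) →
    if does (i Fin.≟ k) then (if does (j Fin.≟ k) then con K.1# else con K.0#) else var (y i j i≤j)

  φ-Y-other : ∀ {i} j → i ≢ k → φ (Y i j) ≃ Y i j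
  φ-Y-other {i} j i≢k with i Fin.≤? j
  ... | no _ = ≃-refl
  ... | yes _ rewrite dec-false (i Fin.≟ k) i≢k = ≃-refl

  φ-Y-kk : φ (Y k k) ≃ con K.1#
  φ-Y-kk rewrite Y-≤ {k} {k} Fin.≤-refl | dec-true (k Fin.≟ k) ≡.refl = ≃-refl

  φ-Y-k : ∀ {j} → j ≢ k → φ (Y k j) ≃ con K.0#
  φ-Y-k {j} j≢k with k Fin.≤? j
  ... | no _ = ≃-refl
  ... | yes _ rewrite dec-true (k Fin.≟ k) ≡.refl | dec-false (j Fin.≟ k) j≢k = ≃-refl

  φ-Y-cancellable : ∀ i → Cancellable (φ (Y i i))
  φ-Y-cancellable i with i Fin.≟ k
  ... | yes ≡.refl = cancellable-cong (≃-sym φ-Y-kk) 1-cancellable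
  ... | no i≢k = cancellable-cong (≃-sym (φ-Y-other i i≢k))
    (≡.subst Cancellable (≡.sym (Y-≤ {i} {i} Fin.≤-refl))
      (Division.var-cancellable K.commutativeSemiring _≟ᴵ_ _))

  -- `elements S` is increasing, so the matrix is upper triangular; its diagonal entries are
  -- variables, except for a 1 when `k` lies in `S`.
  φ-principal-cancellable : ∀ S → Cancellable (φ (minor S S ≡.refl))
  φ-principal-cancellable S = cancellable-cong
    (≃-sym (eval-det _ λ a b → Y (element S a) (element S (cast ≡.refl b))))
    (Det.det-upper-cancellable _ upper λ a → ≡.subst
      (λ b → Cancellable (φ (Y (element S a) (element S b))))
      (≡.sym (Fin.cast-is-id ≡.refl a)) (φ-Y-cancellable (element S a)))
    where
    upper : ∀ a b → b Fin.< a → φ (Y (element S a) (element S (cast ≡.refl b))) ≃ con K.0#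
    upper a b b<a rewrite Fin.cast-is-id ≡.refl b
      | Y-≰ {element S a} {element S b} (ℕ.<⇒≱ (element-mono-< S b<a)) = ≃-refl

  sgn-con : ∀ {m} (j : Fin m) → Det.sgn j ≃ con (Detᴷ.sgn j)
  sgn-con zero    = ≃-refl
  sgn-con (suc j) = ≃-trans (⊗-cong (⊗-idʳ _) (sgn-con j)) (≃-sym (con-* _ _))

  -- All that matters of a sign is that multiplying by it twice has no effect, so it is kept as a
  -- square root of one.
  record Sign : Set (c ⊔ ℓ₁) where
    field
      value  : K.Carrier
      square : value K.* value K.≈ K.1#

  -- Sizes and index functions are variables so that the size equations can be matched with `refl`,
  -- which is impossible between cardinalities of given subsets. After `det-unit-row` the remaining
  -- rows differ from `k`, and `φ` leaves them alone.
  φ-det-insert : ∀ {m m⁺ p p⁺} (ρ : Fin m → Fin n) (ρ⁺ : Fin m⁺ → Fin n)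
    (σ : Fin p → Fin n) (σ⁺ : Fin p⁺ → Fin n) (cρ : suc m ≡ m⁺) (cσ : suc p ≡ p⁺)
    (e : m ≡ p) (e⁺ : m⁺ ≡ p⁺) r s →
    ρ⁺ (cast cρ r) ≡ k → (∀ a → ρ⁺ (cast cρ (punchIn r a)) ≡ ρ a) →
    σ⁺ (cast cσ s) ≡ k → (∀ a → σ⁺ (cast cσ (punchIn s a)) ≡ σ a) →
    (∀ a → ρ a ≢ k) → (∀ a → σ a ≢ k) →
    φ (det λ a b → Y (ρ⁺ a) (σ⁺ (cast e⁺ b))) ≃
    con (Detᴷ.sgn r K.* Detᴷ.sgn s) ⊗ det λ a b → Y (ρ a) (σ (cast e b))
  φ-det-insert {m} ρ ρ⁺ σ σ⁺ ≡.refl ≡.refl ≡.refl e⁺ r s ρr ρ′ σs σ′ ρ≢k σ≢k = begin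
    φ (det λ a b → Y (ρ⁺ a) (σ⁺ (cast e⁺ b)))
      ≈⟨ eval-det _ (λ a b → Y (ρ⁺ a) (σ⁺ (cast e⁺ b))) ⟩
    det matrix
      ≈⟨ Det.det-unit-row matrix r s one others ⟩
    (Det.sgn r ⊗ Det.sgn s) ⊗ det (λ a b → matrix (punchIn r a) (punchIn s b))
      ≈⟨ ⊗-cong (≃-trans (⊗-cong (sgn-con r) (sgn-con s)) (≃-sym (con-* _ _)))
           (Det.det-cong (λ a b → matrix (punchIn r a) (punchIn s b))
             (λ a b → Y (ρ a) (σ (cast ≡.refl b))) rest) ⟩
    con (Detᴷ.sgn r K.* Detᴷ.sgn s) ⊗ det (λ a b → Y (ρ a) (σ (cast ≡.refl b))) ∎
    where
    matrix : Fin (suc m) → Fin (suc m) → K[Y]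
    matrix a b = φ (Y (ρ⁺ a) (σ⁺ (cast e⁺ b)))

    ρ⁺-r : ρ⁺ r ≡ k
    ρ⁺-r = ≡.trans (≡.cong ρ⁺ (≡.sym (Fin.cast-is-id ≡.refl r))) ρr

    ρ⁺-punchIn : ∀ a → ρ⁺ (punchIn r a) ≡ ρ a
    ρ⁺-punchIn a = ≡.trans (≡.cong ρ⁺ (≡.sym (Fin.cast-is-id ≡.refl (punchIn r a)))) (ρ′ a)

    one : matrix r s ≃ con K.1#
    -- `σs` speaks of a cast along `refl` and the goal of one along `e⁺`; irrelevance identifies
    -- them.
    one rewrite ρ⁺-r | σs = φ-Y-kk

    others : ∀ j → matrix r (punchIn s j) ≃ con K.0#
    others j rewrite ρ⁺-r | σ′ j = φ-Y-k (σ≢k j)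

    rest : ∀ a b → matrix (punchIn r a) (punchIn s b) ≃ Y (ρ a) (σ (cast ≡.refl b))
    rest a b rewrite ρ⁺-punchIn a | σ′ b | Fin.cast-is-id ≡.refl b = φ-Y-other _ (ρ≢k a)

  -- `f` and `q` are parameters because they must depend on the column alone and not on `R`: all
  -- lifts then gain the same monomial, and the same product of the `q` can be cancelled from a
  -- relation between them. Only the sign may vary with `R`.
  record LiftedColumn (S Ŝ R : Subset n) (R≤Ŝ : R ≤ˢ Ŝ) (f : ℤX.Carrier) (q : K[Y]) :
         Set (c ⊔ ℓ₁) where
    field
      lifted   : Subset n
      lifted≤  : lifted ≤ˢ S
      monomial : ∏∈ X lifted var ≋ f ⊗ ∏∈ X R var
      sign     : Sign
      φ-minor  : φ (minor lifted S (_≤ˢ_.card lifted≤)) ≃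
                 con (Sign.value sign) ⊗ (q ⊗ minor R Ŝ (_≤ˢ_.card R≤Ŝ))

  +1ˢ : Sign
  +1ˢ = record { value = K.1# ; square = K.*-identityˡ K.1# }

  element≢ : ∀ {R} → k ∉ R → ∀ a → element R a ≢ k
  element≢ {R} k∉R a eq = k∉R (≡.subst (_∈ R) eq (element-∈ R a))

  -- `R` is empty, so its minor and its monomial are 1, and the principal minor of `S` provides the
  -- whole divisor, with no sign.
  lift-removed-column : ∀ S R (R≤∅ : R ≤ˢ ∅) →
    LiftedColumn S ∅ R R≤∅ (∏∈ X S var) (φ (minor S S ≡.refl))
  lift-removed-column S R R≤∅ = record
    { lifted = S ; lifted≤ = ≤ˢ-refl S
    ; monomial = ℤX.sym (ℤX.trans
        (ℤX.*-congˡ (ℤX.trans (ℤX.sym (∏-elements X R var)) (empty-∏ _ ∣R∣≡0)))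
        (ℤX.*-identityʳ _))
    ; sign = +1ˢ
    ; φ-minor = ≃-sym (≃-trans (⊗-idˡ _) (≃-trans (⊗-cong ≃-refl (empty-det _ ∣R∣≡0)) (⊗-idʳ _))) }
    where
    ∣R∣≡0 : ∣ R ∣ ≡ 0
    ∣R∣≡0 = ≡.trans (_≤ˢ_.card R≤∅) (∣⊥∣≡0 n)
    empty-∏ : ∀ {m} (f : Fin m → ℤX.Carrier) → m ≡ 0 → BigOperators.∏ X f ≋ con (+ 1)
    empty-∏ f ≡.refl = ℤX.refl
    empty-det : ∀ {m} (a : Fin m → Fin m → K[Y]) → m ≡ 0 → det a ≃ con K.1#
    empty-det a ≡.refl = ≃-refl

  lift-insert : ∀ {S Ŝ R} (R≤Ŝ : R ≤ˢ Ŝ) → k ∉ R → Insert k Ŝ S →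
                LiftedColumn S Ŝ R R≤Ŝ (var k) (con K.1#)
  lift-insert {S} {Ŝ} {R} R≤Ŝ k∉R insS with insert k∉R
  ... | R⁺ , insR = record
    { lifted = R⁺ ; lifted≤ = ≤ˢ-insert R≤Ŝ insR insS
    ; monomial = ∏∈-insert X var insR
    ; sign = record
      { value = Detᴷ.sgn r.position K.* Detᴷ.sgn s.position
      ; square = K.trans (interchange _ _ _ _)
          (K.trans (K.*-cong (Detᴷ.sgn-square r.position) (Detᴷ.sgn-square s.position))
            (K.*-identityˡ _)) }
    ; φ-minor = ≃-trans
        (φ-det-insert (element R) (element R⁺) (element Ŝ) (element S) r.card s.card
          (_≤ˢ_.card R≤Ŝ) (_≤ˢ_.card (≤ˢ-insert R≤Ŝ insR insS)) r.position s.position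
          r.at r.others s.at s.others (element≢ k∉R) (element≢ (insert-∉ insS)))
        (⊗-cong ≃-refl (≃-sym (⊗-idˡ _))) }
    where
    module r = Position (insert-position insR)
    module s = Position (insert-position insS)
    open CommutativeSemigroupProperties K.*-commutativeSemigroup using (interchange)

  lift-same : ∀ {S Ŝ R} (R≤Ŝ : R ≤ˢ Ŝ) → k ∉ R → Ŝ ≡ S →
              LiftedColumn S Ŝ R R≤Ŝ (con (+ 1)) (con K.1#)
  lift-same {S} {R = R} R≤S k∉R ≡.refl = record
    { lifted = R ; lifted≤ = R≤S ; monomial = ℤX.sym (ℤX.*-identityˡ _) ; sign = +1ˢ
    ; φ-minor = ≃-trans (eval-det _ λ a b → Y (element R a) (element S (cast (_≤ˢ_.card R≤S) b)))
        (≃-trans (Det.det-cong _ _ λ a b → φ-Y-other _ (element≢ k∉R a))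
          (≃-trans (≃-sym (⊗-idˡ _)) (≃-sym (⊗-cong ≃-refl (⊗-idˡ _))))) }

  factor : Fin n → ℤX.Carrier
  factor j = if does (j Fin.≟ l) then ∏∈ X (D j) var
             else if does (k ∈? D j) then var k else con (+ 1)

  divisor : Fin n → K[Y]
  divisor j = if does (j Fin.≟ l) then φ (minor (D j) (D j) ≡.refl) else con K.1#

  lift-column : ∀ j {R} (R≤ : R ≤ˢ remove k l D j) → k ∉ R →
                LiftedColumn (D j) (remove k l D j) R R≤ (factor j) (divisor j)
  lift-column j {R} R≤ k∉R = go (j Fin.≟ l) (k ∈? D j) R≤
    where
    -- With the two decisions abstracted, `remove`, `factor` and `divisor` reduce together in each
    -- case.
    go : ∀ (j≟l : Dec (j ≡ l)) (k∈? : Dec (k ∈ D j)) (R≤ : R ≤ˢ (if does j≟l then ∅ else D j - k)) →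
      LiftedColumn (D j) (if does j≟l then ∅ else D j - k) R R≤
        (if does j≟l then ∏∈ X (D j) var
         else if does k∈? then var k else con (+ 1))
        (if does j≟l then φ (minor (D j) (D j) ≡.refl) else con K.1#)
    go (yes _) _         R≤ = lift-removed-column (D j) R R≤
    go (no _)  (yes k∈D) R≤ = lift-insert R≤ k∉R (insert-remove k∈D)
    go (no _)  (no k∉D)  R≤ = lift-same R≤ k∉R (remove-∉ k∉D)

  divisor-cancellable : Cancellable (∏ divisor)
  divisor-cancellable = ∏-cancellable divisor λ j → go j (does (j Fin.≟ l))
    where
    go : ∀ j b → Cancellable (if b then φ (minor (D j) (D j) ≡.refl) else con K.1#)
    go j true  = φ-principal-cancellable (D j)
    go j false = 1-cancellable

-- Lifting whole diagrams, and independence of the lifted generators.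

module LiftedDiagrams {c ℓ₁ ℓ₂} (K : HeytingField c ℓ₁ ℓ₂) {n : ℕ} (k l : Fin n)
                      (D : Diagram n) where
  private
    X = ℤ[x]-semiring n
    R = commutativeRing K
    module K = CommutativeRing R
    module ℤX = CommutativeRing (ℤ[x]-ring n)
    module ∏ᴷ = BigOperatorProperties K.commutativeSemiring
    module ∏ᶻ = BigOperatorProperties X
    D̂ = remove k l D
  open FlaggedWeyl K n using (Index; K[Y]; minor; generator)
  open FlaggedWeylProperties K n using (con-∏)
  open Lifting K k l D
  open PolynomialRing R Index
  open BigOperators polySemiring
  open BigOperatorProperties polySemiring
  open Combinations R Index
  open SetoidReasoning (CommutativeSemiring.setoid polySemiring)
  open SubsetProduct
  open Weight

  Unused : Pred (Σ (Diagram n) (_≤ᴰ D̂)) 0ℓ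
  Unused (C , _) = ∀ j → k ∉ C j

  module _ (x : Σ (Diagram n) (_≤ᴰ D̂)) (u : Unused x) where
    private
      C = proj₁ x
      C≤D̂ = proj₂ x
      module Column j = LiftedColumn (lift-column j (C≤D̂ j) (u j))

      minors lifts : Fin n → K[Y]
      minors j = minor (C j) (D̂ j) (_≤ˢ_.card (C≤D̂ j))
      lifts  j = minor (Column.lifted j) (D j) (_≤ˢ_.card (Column.lifted≤ j))

      signs : Fin n → K.Carrier
      signs j = Sign.value (Column.sign j)

    lift : Σ (Diagram n) (_≤ᴰ D)
    lift = Column.lifted , Column.lifted≤

    lift-sign : K.Carrier
    lift-sign = BigOperators.∏ K.commutativeSemiring signs

    lift-sign-square : lift-sign K.* lift-sign K.≈ K.1#
    lift-sign-square = K.trans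
      (K.sym (∏ᴷ.∏-distrib-* signs signs))
      (∏ᴷ.∏-one (λ j → signs j K.* signs j) λ j → Sign.square (Column.sign j))

    φ-generator : φ (generator D lift) ≃ con lift-sign ⊗ (∏ divisor ⊗ generator D̂ x)
    φ-generator = begin
      φ (∏ lifts)
        ≈⟨ Evaluation.eval-∏ K.commutativeSemiring polySemiring {h = con} _ ≃-refl lifts ⟩
      ∏ (λ j → φ (lifts j))
        ≈⟨ ∏-cong _ (λ j → con (signs j) ⊗ (divisor j ⊗ minors j)) (λ j → Column.φ-minor j) ⟩
      ∏ (λ j → con (signs j) ⊗ (divisor j ⊗ minors j))
        ≈⟨ ∏-distrib-* (λ j → con (signs j)) (λ j → divisor j ⊗ minors j) ⟩
      ∏ (λ j → con (signs j)) ⊗ ∏ (λ j → divisor j ⊗ minors j)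
        ≈⟨ ⊗-cong (con-∏ signs) (∏-distrib-* divisor minors) ⟩
      con lift-sign ⊗ (∏ divisor ⊗ ∏ minors) ∎

    -- The lift collects its new factors column by column, `removedMonomial` separates row `k` from
    -- column `l`. Each `factor j` is split accordingly, and the product of the second parts has a
    -- nontrivial factor only at `l`.
    weight-lift : weight X var (proj₁ lift) ≋
                  removedMonomial k l D ⊗ weight X var C
    weight-lift = ℤX.trans
      (∏ᶻ.∏-cong _ (λ j → factor j ⊗ ∏∈ X (C j) var)
        (λ j → Column.monomial j))
      (ℤX.trans (∏ᶻ.∏-distrib-* factor (λ j → ∏∈ X (C j) var))
        (ℤX.*-congʳ (ℤX.trans (∏ᶻ.∏-cong factor (λ j → row j ⊗ column j) split)
          (ℤX.trans (∏ᶻ.∏-distrib-* row column) (ℤX.*-congˡ (ℤX.trans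
            (∏ᶻ.∏-single column l column≢l) column-l))))))
      where
      row column : Fin n → ℤX.Carrier
      row j = if does (j Fin.≟ l) then con (+ 1) else if does (k ∈? D j) then var k else con (+ 1)
      column j = if does (j Fin.≟ l) then ∏∈ X (D j) var else con (+ 1)

      split : ∀ j → factor j ≋ row j ⊗ column j
      split j with does (j Fin.≟ l)
      ... | true  = ℤX.sym (ℤX.*-identityˡ _)
      ... | false = ℤX.sym (ℤX.*-identityʳ _)

      column-l : column l ≋ ∏∈ X (D l) var
      column-l rewrite dec-true (l Fin.≟ l) ≡.refl = ℤX.refl

      column≢l : ∀ j → j ≢ l → column j ≋ con (+ 1)
      column≢l j j≢l rewrite dec-false (j Fin.≟ l) j≢l = ℤX.refl

  -- The signs differ between generators, so after cancelling `∏ divisor` independence yields that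
  -- each `λs a` times its sign vanishes; multiplying by the sign once more frees `λs a`.
  lift-independent : ∀ {m} (js : Fin m → Σ (Diagram n) (_≤ᴰ D̂)) (u : ∀ a → Unused (js a)) →
    Independent (generator D̂ ∘ js) → Independent (λ a → generator D (lift (js a) (u a)))
  lift-independent js u indep λs eq a = K.trans (K.sym (K.*-identityʳ _)) (K.trans
    (K.*-congˡ (K.sym (lift-sign-square (js a) (u a))))
    (K.trans (K.sym (K.*-assoc _ _ _)) (K.trans (K.*-congʳ (indep μs relation a)) (K.zeroˡ _))))
    where
    s : ∀ a → K.Carrier
    s a = lift-sign (js a) (u a)

    μs : ∀ a → K.Carrier
    μs a = λs a K.* s a

    relation : comb μs (generator D̂ ∘ js) ≃ con K.0#
    relation = divisor-cancellable _ (begin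
      ∏ divisor ⊗ comb μs (generator D̂ ∘ js)
        ≈⟨ comb-⊗ (∏ divisor) μs (generator D̂ ∘ js) ⟩
      comb μs (λ a → ∏ divisor ⊗ generator D̂ (js a))
        ≈⟨ ∑-cong _ (λ a → con (λs a) ⊗ φ (generator D (lift (js a) (u a)))) (λ a → ≃-trans
             (⊗-cong (con-* _ _) ≃-refl) (≃-trans (⊗-assoc _ _ _)
             (⊗-cong ≃-refl (≃-sym (φ-generator (js a) (u a)))))) ⟩
      comb λs (λ a → φ (generator D (lift (js a) (u a))))
        ≈⟨ IsLinear.comb-homo (eval-isLinear _) λs (λ a → generator D (lift (js a) (u a))) ⟨
      φ (comb λs λ a → generator D (lift (js a) (u a)))
        ≈⟨ IsLinear.cong (eval-isLinear _) eq ⟩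
      con K.0# ∎)

-- Comparing the two characters through bases that share the lifted part.

module Decomposition {c ℓ₁ ℓ₂} (K : HeytingField c ℓ₁ ℓ₂) (char0 : CharacteristicZero K)
                     {n : ℕ} (D : Diagram n) (k l : Fin n) where
  private
    X = ℤ[x]-semiring n
    module ℤX = CommutativeRing (ℤ[x]-ring n)
    D̂ = remove k l D
    ℕ[x]-semiring = PolynomialSemiring.polySemiring ℕ.+-*-commutativeSemiring (Fin n)
  open FlaggedWeyl K n using (generator)
  open FlaggedWeylProperties K n using (weights; isχ)
  open LiftedDiagrams K k l D
  open Bases K char0 n
  open Weight

  Used : Pred (Σ (Diagram n) (_≤ᴰ D̂)) 0ℓ
  Used (C , _) = Σ (Fin n) λ j → k ∈ C j

  used? : Decidable Used
  used? (C , _) = Fin.any? λ j → k ∈? C j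

  unused? : Decidable Unused
  unused? (C , _) = Fin.all? λ j → ¬? (k ∈? C j)

  setZero-value : Fin n → ℤX.Carrier
  setZero-value i = if does (i Fin.≟ k) then con (+ 0) else var i

  setZero-weight : ∀ C → setZero k (weight X var C) ≋
                         weight X setZero-value C
  setZero-weight =
    WeightEvaluation.eval-weight ℤ.+-*-commutativeSemiring X ℤX.refl setZero-value

  setZero-unused : ∀ x → Unused x → setZero k (weight X var (proj₁ x)) ≋
                                    weight X var (proj₁ x)
  setZero-unused (C , _) u = ℤX.trans (setZero-weight C) (∏-cong _ _ λ j →
    ∏-cong _ (λ i → if does (i ∈? C j) then var i else con (+ 1)) λ i → go j i)
    where
    open BigOperatorProperties X
    go : ∀ j i → (if does (i ∈? C j) then setZero-value i else con (+ 1)) ≋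
                 (if does (i ∈? C j) then var i else con (+ 1))
    go j i with i ∈? C j
    ... | no _ = ℤX.refl
    ... | yes i∈C rewrite dec-false (i Fin.≟ k) (λ { ≡.refl → u j i∈C }) = ℤX.refl

  setZero-used : ∀ x → Used x → setZero k (weight X var (proj₁ x)) ≋ con (+ 0)
  setZero-used (C , _) (j , k∈C) = ℤX.trans (setZero-weight C)
    (∏-zero (λ j → ∏∈ (C j) setZero-value) j
      (∏-zero (λ i → if does (i ∈? C j) then setZero-value i else con (+ 1)) k vanishes))
    where
    open BigOperatorProperties X
    open SubsetProduct X
    vanishes : (if does (k ∈? C j) then setZero-value k else con (+ 1)) ≋ con (+ 0)
    vanishes rewrite dec-true (k ∈? C j) k∈C | dec-true (k Fin.≟ k) ≡.refl = ℤX.refl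

  extension-of-empty : ∀ {m} {js : Fin m → Σ (Diagram n) (_≤ᴰ D̂)} →
    Extension (generator D̂) (generator-over D̂) Unused []ᶠ js → ∀ a → Unused (js a)
  extension-of-empty (add Qx e) zero    = Qx
  extension-of-empty (add Qx e) (suc a) = extension-of-empty e a

  setZero-extension : ∀ {m m′} {js : Fin m → Σ (Diagram n) (_≤ᴰ D̂)}
    {ks : Fin m′ → Σ (Diagram n) (_≤ᴰ D̂)} →
    (∀ a → Unused (js a)) → Extension (generator D̂) (generator-over D̂) Used js ks →
    setZero k (weights ks) ≋ weights js
  setZero-extension {js = js} unused done = go js unused
    where
    go : ∀ {m} (js : Fin m → Σ (Diagram n) (_≤ᴰ D̂)) → (∀ a → Unused (js a)) →
         setZero k (weights js) ≋ weights js
    go {zero}  js u = ℤX.refl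
    go {suc m} js u = ℤX.+-cong (setZero-unused (js zero) (u zero)) (go (js ∘ suc) (u ∘ suc))
  setZero-extension unused (add {x = x} x-used e) =
    ℤX.trans (ℤX.+-cong (setZero-used x x-used) (setZero-extension unused e)) (ℤX.+-identityˡ _)

  -- `F` is assembled in `ℕ[x]` from the monomials of the added generators, so its positivity holds
  -- by construction; `eval-weight` identifies their images in `ℤ[x]`.
  weights-extension : ∀ {m m′} {js : Fin m → Σ (Diagram n) (_≤ᴰ D)}
    {ks : Fin m′ → Σ (Diagram n) (_≤ᴰ D)} →
    Extension (generator D) (generator-over D) (λ _ → ⊤ {0ℓ}) js ks →
    Σ (ℕ[x] n) λ F → weights ks ≋ weights js ⊕ fromℕ[x] F
  weights-extension done = con 0 , ℤX.sym (ℤX.+-identityʳ _)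
  weights-extension (add {x = x} _ e) with weights-extension e
  ... | F , eq = weight ℕ[x]-semiring var (proj₁ x) ⊕ F , ℤX.trans
    (ℤX.+-cong (ℤX.sym (WeightEvaluation.eval-weight ℕ.+-*-commutativeSemiring X
      ℤX.refl var (proj₁ x))) eq)
    (x∙yz≈y∙xz _ _ _)
    where open CommutativeSemigroupProperties ℤX.+-commutativeSemigroup using (x∙yz≈y∙xz)

  weights-lift : ∀ {m} (js : Fin m → Σ (Diagram n) (_≤ᴰ D̂)) (u : ∀ a → Unused (js a)) →
    weights (λ a → lift (js a) (u a)) ≋ removedMonomial k l D ⊗ weights js
  weights-lift js u = ℤX.trans
    (BigOperatorProperties.∑-cong X _
      (λ a → removedMonomial k l D ⊗ weight X var (proj₁ (js a)))
      λ a → weight-lift (js a) (u a))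
    (ℤX.sym (SemiringSum.*-distribˡ-sum ℤX.semiring (removedMonomial k l D)
      λ a → weight X var (proj₁ (js a))))

  module _ (U : Completion (generator D̂) (generator-over D̂) Unused []ᶠ (diagrams≤ D̂)) where
    private module U = Completion U

    unused : ∀ a → Unused (U.indices a)
    unused = extension-of-empty U.extension

    lifts : Fin U.dim → Σ (Diagram n) (_≤ᴰ D)
    lifts a = lift (U.indices a) (unused a)

    lifts-complemented : Complemented (generator D ∘ lifts)
    lifts-complemented = complement 1≉0 (generator D ∘ lifts) (λ a → generator-over D (lifts a))
      (lift-independent U.indices unused (Complemented.independent U.complemented))

    decompose : Completion (generator D̂) (generator-over D̂) Used U.indices (diagrams≤ D̂) →
      Completion (generator D) (generator-over D) (λ _ → ⊤ {0ℓ}) lifts (diagrams≤ D) →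
      Σ (ℤ[x] n) λ χ → Σ (ℤ[x] n) λ χ′ →
      Isχ K D χ × Isχ K D̂ χ′ ×
      Σ (ℕ[x] n) λ F → χ ≋ removedMonomial k l D ⊗ setZero k χ′ ⊕ fromℕ[x] F
    decompose V W = weights W.indices , weights V.indices , χ-D , χ-D̂ , F , χ-identity
      where
      module V = Completion V
      module W = Completion W

      -- `V` accounts only for generators that meet row `k`; the others were covered by `U`, whose
      -- span persists in the extension.
      removed-spans : ∀ {x} → x ∈ᴸ diagrams≤ D̂ → InSpan (generator D̂ ∘ V.indices) (generator D̂ x)
      removed-spans {x} x∈ = go (used? x)
        where
        go : Dec (Used x) → InSpan (generator D̂ ∘ V.indices) (generator D̂ x)
        go (yes x-used) = V.spans x∈ x-used
        go (no ¬used)   = InSpan-extension (generator D̂) (generator-over D̂) V.extension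
                            (U.spans x∈ λ j k∈ → ¬used (j , k∈))

      χ-D : Isχ K D (weights W.indices)
      χ-D = isχ D W.indices (isBasis D W.indices W.complemented λ x∈ → W.spans x∈ tt)

      χ-D̂ : Isχ K D̂ (weights V.indices)
      χ-D̂ = isχ D̂ V.indices (isBasis D̂ V.indices V.complemented removed-spans)

      F = proj₁ (weights-extension W.extension)

      step₁ : weights W.indices ≋ weights lifts ⊕ fromℕ[x] F
      step₁ = proj₂ (weights-extension W.extension)

      step₂ : weights lifts ≋ removedMonomial k l D ⊗ weights U.indices
      step₂ = weights-lift U.indices unused

      step₃ : setZero k (weights V.indices) ≋ weights U.indices
      step₃ = setZero-extension unused V.extension

      χ-identity : weights W.indices ≋
                   removedMonomial k l D ⊗ setZero k (weights V.indices) ⊕ fromℕ[x] F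
      χ-identity = ℤX.trans step₁ (ℤX.+-congʳ (ℤX.trans step₂ (ℤX.*-congˡ (ℤX.sym step₃))))

theorem5p8 : ∀ {c ℓ₁ ℓ₂} (K : HeytingField c ℓ₁ ℓ₂) → CharacteristicZero K →
    (n : ℕ) (D : Diagram n) (k l : Fin n) →
    Σ (ℤ[x] n) λ χ → Σ (ℤ[x] n) λ χ′ →
    Isχ K D χ × Isχ K (remove k l D) χ′ ×
    Σ (ℕ[x] n) λ F → χ ≋ removedMonomial k l D ⊗ setZero k χ′ ⊕ fromℕ[x] F
theorem5p8 K char0 n D k l = decompose unusedPart
  (complete-basis (generator D̂) (generator-over D̂) used? U.indices U.complemented (diagrams≤ D̂))
  (complete-basis (generator D) (generator-over D) (λ _ → yes tt) (lifts unusedPart)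
    (lifts-complemented unusedPart) (diagrams≤ D))
  where
  open FlaggedWeyl K n using (generator)
  open LiftedDiagrams K k l D using (Unused)
  open Bases K char0 n
  open Decomposition K char0 D k l
  D̂ = remove k l D

  -- This one family is both the source of the lifts and the part of the basis of `ℳ D̂` that
  -- survives setting x_k to zero, which is what makes the two characters comparable.
  unusedPart : Completion (generator D̂) (generator-over D̂) Unused []ᶠ (diagrams≤ D̂)
  unusedPart =
    complete-basis (generator D̂) (generator-over D̂) unused? []ᶠ (empty _) (diagrams≤ D̂)

  module U = Completion unusedPart
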